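{- Let $(X,\mathbf R)$ be a symmetric association scheme with $D$ classes which is cometric with respect to the ordering $E_0,\dots,E_D$. Fix $x\in X$ and write $E_k^*=E_k^*(x)$. Let $\chi\in V$ be a code and set $\delta^*=\delta^*(\chi)$, $s_x=s_x(\chi)$. Then for every $0\le k\le D$, $E_k^*\chi$ is a relative $(\delta^*-s_x)$-design with respect to $x$; that is, $E_jE_k^*\chi\in\mathbb C E_j\hat x$ for all $1\le j\le \delta^*-s_x$.
   Context: $(X,\mathbf R)$ is a symmetric association scheme with associate matrices $A_0=I,\dots,A_D$, Bose–Mesner algebra $M$, and primitive idempotents $E_0=|X|^{ -1}J,E_1,\dots,E_D$. Cometric (Q-polynomial) with respect to $E_0,\dots,E_D$ means that for each $j$, $E_j$ is a polynomial of degree exactly $j$ in $E_1$ with respect to entrywise (Hadamard) multiplication. $V=\mathbb C^X$ with standard basis $\{\hat y\}$ and standard Hermitian inner product. $E_k^*(x)$ is the diagonal matrix with $(E_k^*(x))_{yy}=(A_k)_{xy}$. A code is a vector $\chi\notin E_0V$ with $\chi\notin E_0^*(z)V$ for all $z\in X$. $\delta^*(\chi)=\min\{j\ne0:E_j\chi\ne0\}$, $s_x(\chi)=|\{i\ne0:E_i^*(x)\chi\ne0\}|$. A vector $\psi$ is a relative $t$-design with respect to $x$ if $E_j\psi$ and $E_j\hat x$ are linearly dependent for all $1\le j\le t$ (vacuous if $t\le 0$). -}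

module Defs where

open import Level using (0ℓ)
open import Algebra.Bundles using (CommutativeMonoid; CommutativeRing)
open import Algebra.Definitions
  using (Congruent₁; Congruent₂; Associative; Commutative; LeftIdentity;
         LeftInverse)
  renaming (_DistributesOverˡ_ to DistributesOverˡ)
open import Algebra.Structures using (IsCommutativeRing)
import Algebra.Consequences.Setoid as Consequences
import Algebra.Properties.CommutativeSemigroup as CommutativeSemigroupProperties
import Algebra.Properties.Ring as RingProperties
open import Data.Fin.Base using (Fin; zero; suc; toℕ; fromℕ)
import Data.Fin.Properties as Fin
open import Data.Fin.Subset using (Subset; _∈_; ∣_∣)
open import Data.Integer.Base as ℤ using (ℤ)
open import Data.List.Base using (length; filter; allFin)
open import Data.Nat.Base as ℕ using (ℕ; zero; suc)
import Data.Nat.Properties as ℕ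
open import Data.Product.Base using (∃; ∃₂; ∃-syntax; _×_; _,_)
open import Data.Rational.Base as ℚ using (ℚ; 0ℚ; 1ℚ; ½)
import Data.Rational.Properties as ℚ
open import Data.Vec.Functional using (Vector)
open import Function.Bundles using (_⇔_)
open import Relation.Binary.Bundles using (Setoid)
open import Relation.Binary.Structures using (IsEquivalence)
open import Relation.Binary.PropositionalEquality
  using (_≡_; _≢_; refl; sym; trans; cong; subst)
open import Relation.Nullary.Decidable.Core using (yes; no; _×-dec_; dec⇒maybe)
open import Relation.Nullary.Negation.Core using (¬_)
import Algebra.Properties.Semiring.Exp as Exp
import Algebra.Properties.Semiring.Sum as Sum
import Data.Vec.Functional.Relation.Binary.Equality.Setoid as VectorEquality
import Relation.Binary.Reasoning.Setoid as SetoidReasoning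
import Tactic.RingSolver.Core.AlmostCommutativeRing as ACR
open import Tactic.RingSolver using (solve-∀)

private
  module ℚ-Laws where
    open import Data.Rational.Base using (_+_; _*_; -_; _-_)

    ℚ-ring = ACR.fromCommutativeRing ℚ.+-*-commutativeRing
      (λ q → dec⇒maybe (0ℚ ℚ.≟ q))

    minus-plus : ∀ a b → (a - b) + b ≡ a
    minus-plus = solve-∀ ℚ-ring

    sum-of-differences : ∀ a b c d → (a - b) + (c - d) ≡ (a + c) - (b + d)
    sum-of-differences = solve-∀ ℚ-ring

    neg-of-difference : ∀ a b → - (a - b) ≡ (- a) - (- b)
    neg-of-difference = solve-∀ ℚ-ring

    difference-of-products : ∀ a b c d → a * (c - d) + d * (a - b) ≡ (a * c) - (b * d)
    difference-of-products = solve-∀ ℚ-ring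

    swap-difference : ∀ a b → - (a - b) ≡ b - a
    swap-difference = solve-∀ ℚ-ring

    telescope : ∀ a b c → (a - b) + (b - c) ≡ a - c
    telescope = solve-∀ ℚ-ring

  open ℚ-Laws

------------------------------------------------------------------------
-- The real numbers, as Cauchy sequences of rationals modulo null
-- sequences.

IsCauchy : (ℕ → ℚ) → Set
IsCauchy x = ∀ ε → 0ℚ ℚ.< ε →
  ∃[ N ] ∀ m n → N ℕ.≤ m → N ℕ.≤ n → ℚ.∣ x m ℚ.- x n ∣ ℚ.< ε

record ℝ : Set where
  constructor mkℝ
  field
    seq    : ℕ → ℚ
    cauchy : IsCauchy seq

open ℝ public

infix 4 _≃_

record _≃_ (x y : ℝ) : Set where
  constructor mk≃
  field
    close : ∀ ε → 0ℚ ℚ.< ε →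
      ∃[ N ] ∀ n → N ℕ.≤ n → ℚ.∣ seq x n ℚ.- seq y n ∣ ℚ.< ε

open _≃_ public

private
  -- Double sequences tending to 0 treat Cauchyness and ≃ uniformly.
  Null : (ℕ → ℕ → ℚ) → Set
  Null f = ∀ ε → 0ℚ ℚ.< ε →
    ∃[ N ] ∀ m n → N ℕ.≤ m → N ℕ.≤ n → ℚ.∣ f m n ∣ ℚ.< ε

  Bounded : (ℕ → ℕ → ℚ) → Set
  Bounded f = ∃[ B ] ℚ.Positive B ×
    ∃[ N ] ∀ m n → N ℕ.≤ m → N ℕ.≤ n → ℚ.∣ f m n ∣ ℚ.≤ B

  diff : ℝ → ℝ → ℕ → ℕ → ℚ
  diff x y m _ = seq x m ℚ.- seq y m

  ≃⇒Null : ∀ {x y} → x ≃ y → Null (diff x y)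
  ≃⇒Null p ε ε>0 = let N , h = close p ε ε>0 in N , λ m _ N≤m _ → h m N≤m

  Null⇒≃ : ∀ {x y} → Null (diff x y) → x ≃ y
  Null⇒≃ p = mk≃ λ ε ε>0 → let N , h = p ε ε>0 in N , λ n N≤n → h n n N≤n N≤n

  Null-ext : ∀ {f g} → (∀ m n → f m n ≡ g m n) → Null f → Null g
  Null-ext eq p ε ε>0 = let N , h = p ε ε>0 in
    N , λ m n a b → subst (λ q → ℚ.∣ q ∣ ℚ.< ε) (eq m n) (h m n a b)

  Null-0 : Null (λ _ _ → 0ℚ)
  Null-0 ε ε>0 = 0 , λ _ _ _ _ → ε>0

  Null-neg : ∀ {f} → Null f → Null (λ m n → ℚ.- f m n)
  Null-neg {f} p ε ε>0 = let N , h = p ε ε>0 in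
    N , λ m n a b → subst (ℚ._< ε) (sym (ℚ.∣-p∣≡∣p∣ (f m n))) (h m n a b)

  half-positive : ∀ {ε} → 0ℚ ℚ.< ε → 0ℚ ℚ.< ½ ℚ.* ε
  half-positive {ε} ε>0 = ℚ.positive⁻¹ (½ ℚ.* ε)
    {{ℚ.pos*pos⇒pos ½ ε {{ℚ.positive ε>0}}}}

  half+half : ∀ ε → ½ ℚ.* ε ℚ.+ ½ ℚ.* ε ≡ ε
  half+half ε = trans (sym (ℚ.*-distribʳ-+ ε ½ ½)) (ℚ.*-identityˡ ε)

  Null-+ : ∀ {f g} → Null f → Null g → Null (λ m n → f m n ℚ.+ g m n)
  Null-+ {f} {g} p q ε ε>0 =
    let N₁ , h₁ = p (½ ℚ.* ε) (half-positive ε>0)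
        N₂ , h₂ = q (½ ℚ.* ε) (half-positive ε>0)
    in N₁ ℕ.⊔ N₂ , λ m n a b →
      ℚ.≤-<-trans (ℚ.∣p+q∣≤∣p∣+∣q∣ (f m n) (g m n))
        (subst (_ ℚ.<_) (half+half ε)
          (ℚ.+-mono-<
            (h₁ m n (ℕ.m⊔n≤o⇒m≤o N₁ N₂ a) (ℕ.m⊔n≤o⇒m≤o N₁ N₂ b))
            (h₂ m n (ℕ.m⊔n≤o⇒n≤o N₁ N₂ a) (ℕ.m⊔n≤o⇒n≤o N₁ N₂ b))))

  Null-* : ∀ {f g} → Bounded f → Null g → Null (λ m n → f m n ℚ.* g m n)
  Null-* {f} {g} (B , B>0 , N₁ , h₁) p ε ε>0 =
    let instance
          _ = B>0
          _ = ℚ.pos⇒nonZero B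
          _ = ℚ.pos⇒nonNeg B
          _ = ℚ.1/pos⇒pos B
          _ = ℚ.positive ε>0
        N₂ , h₂ = p (ℚ.1/ B ℚ.* ε)
                    (ℚ.positive⁻¹ _ {{ℚ.pos*pos⇒pos (ℚ.1/ B) ε}})
    in N₁ ℕ.⊔ N₂ , λ m n a b →
      subst (ℚ._< ε) (sym (ℚ.∣p*q∣≡∣p∣*∣q∣ (f m n) (g m n)))
        (ℚ.≤-<-trans
          (ℚ.*-monoʳ-≤-nonNeg ℚ.∣ g m n ∣ {{ℚ.∣-∣-nonNeg (g m n)}}
            (h₁ m n (ℕ.m⊔n≤o⇒m≤o N₁ N₂ a) (ℕ.m⊔n≤o⇒m≤o N₁ N₂ b)))
          (subst (B ℚ.* ℚ.∣ g m n ∣ ℚ.<_)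
            (trans (sym (ℚ.*-assoc B (ℚ.1/ B) ε))
              (trans (cong (ℚ._* ε) (ℚ.*-inverseʳ B)) (ℚ.*-identityˡ ε)))
            (ℚ.*-monoʳ-<-pos B
              (h₂ m n (ℕ.m⊔n≤o⇒n≤o N₁ N₂ a) (ℕ.m⊔n≤o⇒n≤o N₁ N₂ b)))))

  bounded : ∀ x → ∃[ B ] ℚ.Positive B ×
            ∃[ N ] ∀ n → N ℕ.≤ n → ℚ.∣ seq x n ∣ ℚ.≤ B
  bounded x =
    let N , h = cauchy x 1ℚ (ℚ.positive⁻¹ 1ℚ)
        c = seq x N
    in 1ℚ ℚ.+ ℚ.∣ c ∣ ,
       ℚ.pos+nonNeg⇒pos 1ℚ ℚ.∣ c ∣ {{ℚ.∣-∣-nonNeg c}} ,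
       N , λ n N≤n →
         ℚ.≤-trans
           (subst (λ q → ℚ.∣ q ∣ ℚ.≤ ℚ.∣ seq x n ℚ.- c ∣ ℚ.+ ℚ.∣ c ∣)
             (minus-plus (seq x n) c)
             (ℚ.∣p+q∣≤∣p∣+∣q∣ (seq x n ℚ.- c) c))
           (ℚ.+-monoˡ-≤ ℚ.∣ c ∣ (ℚ.<⇒≤ (h n N N≤n ℕ.≤-refl)))

  boundedˡ : ∀ x → Bounded (λ m _ → seq x m)
  boundedˡ x = let B , B>0 , N , h = bounded x in
    B , B>0 , N , λ m _ N≤m _ → h m N≤m

  boundedʳ : ∀ x → Bounded (λ _ n → seq x n)
  boundedʳ x = let B , B>0 , N , h = bounded x in
    B , B>0 , N , λ _ n _ N≤n → h n N≤n

fromℚ : ℚ → ℝ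
fromℚ q = mkℝ (λ _ → q) (Null-ext (λ _ _ → sym (ℚ.+-inverseʳ q)) Null-0)

0ℝ 1ℝ : ℝ
0ℝ = fromℚ 0ℚ
1ℝ = fromℚ 1ℚ

infixl 6 _+ℝ_
infixl 7 _*ℝ_
infix  8 -ℝ_

-- The operations of ℝ and ℂ are opaque only to keep conversion checking from
-- unfolding them down to rational arithmetic.
opaque
  _+ℝ_ : ℝ → ℝ → ℝ
  x +ℝ y = mkℝ (λ n → seq x n ℚ.+ seq y n)
    (Null-ext
      (λ m n → sum-of-differences (seq x m) (seq x n) (seq y m) (seq y n))
      (Null-+ (cauchy x) (cauchy y)))

  -ℝ_ : ℝ → ℝ
  -ℝ x = mkℝ (λ n → ℚ.- seq x n)
    (Null-ext (λ m n → neg-of-difference (seq x m) (seq x n))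
      (Null-neg (cauchy x)))

  _*ℝ_ : ℝ → ℝ → ℝ
  x *ℝ y = mkℝ (λ n → seq x n ℚ.* seq y n)
    (Null-ext
      (λ m n → difference-of-products (seq x m) (seq x n) (seq y m) (seq y n))
      (Null-+ (Null-* (boundedˡ x) (cauchy y))
              (Null-* (boundedʳ y) (cauchy x))))

private
  pointwise : ∀ {x y} → (∀ n → seq x n ≡ seq y n) → x ≃ y
  pointwise {x} {y} eq = Null⇒≃ (Null-ext
    (λ m _ → sym (trans (cong (ℚ._- seq y m) (eq m)) (ℚ.+-inverseʳ (seq y m))))
    Null-0)

  ≃-refl : ∀ {x} → x ≃ x
  ≃-refl = pointwise (λ _ → refl)

  ≃-sym : ∀ {x y} → x ≃ y → y ≃ x
  ≃-sym {x} {y} p = Null⇒≃ (Null-ext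
    (λ m _ → swap-difference (seq x m) (seq y m))
    (Null-neg (≃⇒Null p)))

  ≃-trans : ∀ {x y z} → x ≃ y → y ≃ z → x ≃ z
  ≃-trans {x} {y} {z} p q = Null⇒≃ (Null-ext
    (λ m _ → telescope (seq x m) (seq y m) (seq z m))
    (Null-+ (≃⇒Null p) (≃⇒Null q)))

  opaque
    unfolding _+ℝ_

    +ℝ-cong : ∀ {x y u v} → x ≃ y → u ≃ v → x +ℝ u ≃ y +ℝ v
    +ℝ-cong {x} {y} {u} {v} p q = Null⇒≃ (Null-ext
      (λ m _ → sum-of-differences (seq x m) (seq y m) (seq u m) (seq v m))
      (Null-+ (≃⇒Null p) (≃⇒Null q)))

    -ℝ-cong : ∀ {x y} → x ≃ y → -ℝ x ≃ -ℝ y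
    -ℝ-cong {x} {y} p = Null⇒≃ (Null-ext
      (λ m _ → neg-of-difference (seq x m) (seq y m))
      (Null-neg (≃⇒Null p)))

    *ℝ-cong : ∀ {x y u v} → x ≃ y → u ≃ v → x *ℝ u ≃ y *ℝ v
    *ℝ-cong {x} {y} {u} {v} p q = Null⇒≃ (Null-ext
      (λ m _ → difference-of-products (seq x m) (seq y m) (seq u m) (seq v m))
      (Null-+ (Null-* (boundedˡ x) (≃⇒Null q)) (Null-* (boundedˡ v) (≃⇒Null p))))

    +ℝ-assoc : ∀ x y z → (x +ℝ y) +ℝ z ≃ x +ℝ (y +ℝ z)
    +ℝ-assoc x y z = pointwise λ n → ℚ.+-assoc (seq x n) (seq y n) (seq z n)

    +ℝ-comm : ∀ x y → x +ℝ y ≃ y +ℝ x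
    +ℝ-comm x y = pointwise λ n → ℚ.+-comm (seq x n) (seq y n)

    +ℝ-identityˡ : ∀ x → 0ℝ +ℝ x ≃ x
    +ℝ-identityˡ x = pointwise λ n → ℚ.+-identityˡ (seq x n)

    -ℝ-inverseˡ : ∀ x → -ℝ x +ℝ x ≃ 0ℝ
    -ℝ-inverseˡ x = pointwise λ n → ℚ.+-inverseˡ (seq x n)

    *ℝ-assoc : ∀ x y z → (x *ℝ y) *ℝ z ≃ x *ℝ (y *ℝ z)
    *ℝ-assoc x y z = pointwise λ n → ℚ.*-assoc (seq x n) (seq y n) (seq z n)

    *ℝ-comm : ∀ x y → x *ℝ y ≃ y *ℝ x
    *ℝ-comm x y = pointwise λ n → ℚ.*-comm (seq x n) (seq y n)

    *ℝ-identityˡ : ∀ x → 1ℝ *ℝ x ≃ x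
    *ℝ-identityˡ x = pointwise λ n → ℚ.*-identityˡ (seq x n)

    *ℝ-distribˡ : ∀ x y z → x *ℝ (y +ℝ z) ≃ x *ℝ y +ℝ x *ℝ z
    *ℝ-distribˡ x y z = pointwise λ n →
      ℚ.*-distribˡ-+ (seq x n) (seq y n) (seq z n)

  isCommutativeRingˡ : {C : Set} (_≈_ : C → C → Set) (_+_ _*_ : C → C → C)
    (-_ : C → C) (0# 1# : C) → IsEquivalence _≈_ →
    Congruent₂ _≈_ _+_ → Associative _≈_ _+_ → Commutative _≈_ _+_ →
    LeftIdentity _≈_ 0# _+_ → Congruent₁ _≈_ -_ → LeftInverse _≈_ 0# -_ _+_ →
    Congruent₂ _≈_ _*_ → Associative _≈_ _*_ → Commutative _≈_ _*_ →
    LeftIdentity _≈_ 1# _*_ → DistributesOverˡ _≈_ _*_ _+_ →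
    IsCommutativeRing _≈_ _+_ _*_ -_ 0# 1#
  isCommutativeRingˡ _≈_ _+_ _*_ -_ 0# 1# equiv
    +-cong +-assoc +-comm +-idˡ -‿cong -‿invˡ
    *-cong *-assoc *-comm *-idˡ distribˡ = record
    { isRing = record
      { +-isAbelianGroup = record
        { isGroup = record
          { isMonoid = record
            { isSemigroup = record
              { isMagma = record { isEquivalence = equiv ; ∙-cong = +-cong }
              ; assoc = +-assoc
              }
            ; identity = comm∧idˡ⇒id +-comm +-idˡ
            }
          ; inverse = comm∧invˡ⇒inv +-comm -‿invˡ
          ; ⁻¹-cong = -‿cong
          }
        ; comm = +-comm
        }
      ; *-cong = *-cong
      ; *-assoc = *-assoc
      ; *-identity = comm∧idˡ⇒id *-comm *-idˡ
      ; distrib = comm∧distrˡ⇒distr +-cong *-comm distribˡ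
      }
    ; *-comm = *-comm
    }
    where
    setoid : Setoid 0ℓ 0ℓ
    setoid = record { isEquivalence = equiv }

    open Consequences setoid

ℝ-commutativeRing : CommutativeRing 0ℓ 0ℓ
ℝ-commutativeRing = record
  { Carrier = ℝ ; _≈_ = _≃_ ; _+_ = _+ℝ_ ; _*_ = _*ℝ_ ; -_ = -ℝ_
  ; 0# = 0ℝ ; 1# = 1ℝ
  ; isCommutativeRing = isCommutativeRingˡ _≃_ _+ℝ_ _*ℝ_ -ℝ_ 0ℝ 1ℝ
      (record { refl = ≃-refl ; sym = ≃-sym ; trans = ≃-trans })
      +ℝ-cong +ℝ-assoc +ℝ-comm +ℝ-identityˡ -ℝ-cong -ℝ-inverseˡ
      *ℝ-cong *ℝ-assoc *ℝ-comm *ℝ-identityˡ *ℝ-distribˡ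
  }

------------------------------------------------------------------------
-- The complex numbers

infix 3 _+i_
infix 4 _≃ℂ_
infixr 4 _,ᶜ_

record ℂ : Set where
  constructor _+i_
  field
    re im : ℝ

open ℂ public

record _≃ℂ_ (z w : ℂ) : Set where
  constructor _,ᶜ_
  field
    re≃ : re z ≃ re w
    im≃ : im z ≃ im w

open _≃ℂ_ public

0ℂ 1ℂ : ℂ
0ℂ = 0ℝ +i 0ℝ
1ℂ = 1ℝ +i 0ℝ

infixl 6 _+ℂ_
infixl 7 _*ℂ_
infix  8 -ℂ_

opaque
  _+ℂ_ : ℂ → ℂ → ℂ
  z +ℂ w = re z +ℝ re w +i im z +ℝ im w

  -ℂ_ : ℂ → ℂ
  -ℂ z = -ℝ re z +i -ℝ im z

  _*ℂ_ : ℂ → ℂ → ℂ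
  z *ℂ w = re z *ℝ re w +ℝ -ℝ (im z *ℝ im w)
        +i re z *ℝ im w +ℝ im z *ℝ re w

private
  module R = CommutativeRing ℝ-commutativeRing
  open RingProperties R.ring 
    using (-‿distribˡ-*; -‿distribʳ-*; -‿+-comm; -0#≈0#)
  open CommutativeSemigroupProperties
    (CommutativeMonoid.commutativeSemigroup R.+-commutativeMonoid)
    using (interchange)
  open SetoidReasoning R.setoid

  cycle : ∀ p q r s → (p +ℝ q) +ℝ (r +ℝ s) ≃ (p +ℝ r) +ℝ (s +ℝ q)
  cycle p q r s = R.trans (interchange p q r s) (R.+-congˡ (R.+-comm q s))

  -[a+b]c : ∀ a b c → -ℝ ((a +ℝ b) *ℝ c) ≃ -ℝ (a *ℝ c) +ℝ -ℝ (b *ℝ c)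
  -[a+b]c a b c =
    R.trans (R.-‿cong (R.distribʳ c a b)) (R.sym (-‿+-comm _ _))

  -a[b+c] : ∀ a b c → -ℝ (a *ℝ (b +ℝ c)) ≃ -ℝ (a *ℝ b) +ℝ -ℝ (a *ℝ c)
  -a[b+c] a b c =
    R.trans (R.-‿cong (R.distribˡ a b c)) (R.sym (-‿+-comm _ _))

  [a-b]c : ∀ a b c → (a +ℝ -ℝ b) *ℝ c ≃ a *ℝ c +ℝ -ℝ (b *ℝ c)
  [a-b]c a b c =
    R.trans (R.distribʳ c a (-ℝ b)) (R.+-congˡ (R.sym (-‿distribˡ-* b c)))

  a[b-c] : ∀ a b c → a *ℝ (b +ℝ -ℝ c) ≃ a *ℝ b +ℝ -ℝ (a *ℝ c)
  a[b-c] a b c =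
    R.trans (R.distribˡ a b (-ℝ c)) (R.+-congˡ (R.sym (-‿distribʳ-* a c)))

  opaque
    unfolding _+ℂ_

    +ℂ-cong : ∀ {x y u v} → x ≃ℂ y → u ≃ℂ v → x +ℂ u ≃ℂ y +ℂ v
    +ℂ-cong (p ,ᶜ q) (r ,ᶜ s) = R.+-cong p r ,ᶜ R.+-cong q s

    -ℂ-cong : ∀ {x y} → x ≃ℂ y → -ℂ x ≃ℂ -ℂ y
    -ℂ-cong (p ,ᶜ q) = R.-‿cong p ,ᶜ R.-‿cong q

    *ℂ-cong : ∀ {x y u v} → x ≃ℂ y → u ≃ℂ v → x *ℂ u ≃ℂ y *ℂ v
    *ℂ-cong (p ,ᶜ q) (r ,ᶜ s) =
      R.+-cong (R.*-cong p r) (R.-‿cong (R.*-cong q s)) ,ᶜ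
      R.+-cong (R.*-cong p s) (R.*-cong q r)

    +ℂ-assoc : ∀ x y z → (x +ℂ y) +ℂ z ≃ℂ x +ℂ (y +ℂ z)
    +ℂ-assoc _ _ _ = R.+-assoc _ _ _ ,ᶜ R.+-assoc _ _ _

    +ℂ-comm : ∀ x y → x +ℂ y ≃ℂ y +ℂ x
    +ℂ-comm _ _ = R.+-comm _ _ ,ᶜ R.+-comm _ _

    +ℂ-identityˡ : ∀ x → 0ℂ +ℂ x ≃ℂ x
    +ℂ-identityˡ _ = R.+-identityˡ _ ,ᶜ R.+-identityˡ _

    -ℂ-inverseˡ : ∀ x → -ℂ x +ℂ x ≃ℂ 0ℂ
    -ℂ-inverseˡ _ = R.-‿inverseˡ _ ,ᶜ R.-‿inverseˡ _

    *ℂ-assoc : ∀ x y z → (x *ℂ y) *ℂ z ≃ℂ x *ℂ (y *ℂ z)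
    *ℂ-assoc (a +i b) (c +i d) (e +i f) = (begin
        (a *ℝ c +ℝ -ℝ (b *ℝ d)) *ℝ e +ℝ -ℝ ((a *ℝ d +ℝ b *ℝ c) *ℝ f)
      ≈⟨ R.+-cong ([a-b]c _ _ _) (-[a+b]c _ _ _) ⟩
        (a *ℝ c *ℝ e +ℝ -ℝ (b *ℝ d *ℝ e)) +ℝ
        (-ℝ (a *ℝ d *ℝ f) +ℝ -ℝ (b *ℝ c *ℝ f))
      ≈⟨ cycle _ _ _ _ ⟩
        (a *ℝ c *ℝ e +ℝ -ℝ (a *ℝ d *ℝ f)) +ℝ
        (-ℝ (b *ℝ c *ℝ f) +ℝ -ℝ (b *ℝ d *ℝ e))
      ≈⟨ R.+-cong
           (R.+-cong (R.*-assoc _ _ _) (R.-‿cong (R.*-assoc _ _ _)))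
           (R.+-cong (R.-‿cong (R.*-assoc _ _ _)) (R.-‿cong (R.*-assoc _ _ _))) ⟩
        (a *ℝ (c *ℝ e) +ℝ -ℝ (a *ℝ (d *ℝ f))) +ℝ
        (-ℝ (b *ℝ (c *ℝ f)) +ℝ -ℝ (b *ℝ (d *ℝ e)))
      ≈⟨ R.+-cong (a[b-c] _ _ _) (-a[b+c] _ _ _) ⟨
        a *ℝ (c *ℝ e +ℝ -ℝ (d *ℝ f)) +ℝ -ℝ (b *ℝ (c *ℝ f +ℝ d *ℝ e)) ∎)
      ,ᶜ (begin
        (a *ℝ c +ℝ -ℝ (b *ℝ d)) *ℝ f +ℝ (a *ℝ d +ℝ b *ℝ c) *ℝ e
      ≈⟨ R.+-cong ([a-b]c _ _ _) (R.distribʳ _ _ _) ⟩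
        (a *ℝ c *ℝ f +ℝ -ℝ (b *ℝ d *ℝ f)) +ℝ (a *ℝ d *ℝ e +ℝ b *ℝ c *ℝ e)
      ≈⟨ cycle _ _ _ _ ⟩
        (a *ℝ c *ℝ f +ℝ a *ℝ d *ℝ e) +ℝ (b *ℝ c *ℝ e +ℝ -ℝ (b *ℝ d *ℝ f))
      ≈⟨ R.+-cong
           (R.+-cong (R.*-assoc _ _ _) (R.*-assoc _ _ _))
           (R.+-cong (R.*-assoc _ _ _) (R.-‿cong (R.*-assoc _ _ _))) ⟩
        (a *ℝ (c *ℝ f) +ℝ a *ℝ (d *ℝ e)) +ℝ
        (b *ℝ (c *ℝ e) +ℝ -ℝ (b *ℝ (d *ℝ f)))
      ≈⟨ R.+-cong (R.distribˡ _ _ _) (a[b-c] _ _ _) ⟨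
        a *ℝ (c *ℝ f +ℝ d *ℝ e) +ℝ b *ℝ (c *ℝ e +ℝ -ℝ (d *ℝ f)) ∎)

    *ℂ-comm : ∀ x y → x *ℂ y ≃ℂ y *ℂ x
    *ℂ-comm (a +i b) (c +i d) =
      R.+-cong (R.*-comm a c) (R.-‿cong (R.*-comm b d)) ,ᶜ
      R.trans (R.+-comm _ _) (R.+-cong (R.*-comm b c) (R.*-comm a d))

    *ℂ-identityˡ : ∀ x → 1ℂ *ℂ x ≃ℂ x
    *ℂ-identityˡ (a +i b) = (begin
        1ℝ *ℝ a +ℝ -ℝ (0ℝ *ℝ b)  ≈⟨ R.+-cong (R.*-identityˡ a) (-‿distribˡ-* _ _) ⟩
        a +ℝ -ℝ 0ℝ *ℝ b          ≈⟨ R.+-congˡ (R.*-congʳ -0#≈0#) ⟩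
        a +ℝ 0ℝ *ℝ b             ≈⟨ R.+-congˡ (R.zeroˡ b) ⟩
        a +ℝ 0ℝ                  ≈⟨ R.+-identityʳ a ⟩
        a                        ∎)
      ,ᶜ (begin
        1ℝ *ℝ b +ℝ 0ℝ *ℝ a       ≈⟨ R.+-cong (R.*-identityˡ b) (R.zeroˡ a) ⟩
        b +ℝ 0ℝ                  ≈⟨ R.+-identityʳ b ⟩
        b                        ∎)

    *ℂ-distribˡ : ∀ x y z → x *ℂ (y +ℂ z) ≃ℂ x *ℂ y +ℂ x *ℂ z
    *ℂ-distribˡ (a +i b) (c +i d) (e +i f) =
      R.trans (R.+-cong (R.distribˡ a c e) (-a[b+c] b d f)) (interchange _ _ _ _) ,ᶜ
      R.trans (R.+-cong (R.distribˡ a d f) (R.distribˡ b c e)) (interchange _ _ _ _)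

ℂ-commutativeRing : CommutativeRing 0ℓ 0ℓ
ℂ-commutativeRing = record
  { Carrier = ℂ ; _≈_ = _≃ℂ_ ; _+_ = _+ℂ_ ; _*_ = _*ℂ_ ; -_ = -ℂ_
  ; 0# = 0ℂ ; 1# = 1ℂ
  ; isCommutativeRing = isCommutativeRingˡ _≃ℂ_ _+ℂ_ _*ℂ_ -ℂ_ 0ℂ 1ℂ
      (record
        { refl  = ≃-refl ,ᶜ ≃-refl
        ; sym   = λ (p ,ᶜ q) → ≃-sym p ,ᶜ ≃-sym q
        ; trans = λ (p ,ᶜ q) (r ,ᶜ s) → ≃-trans p r ,ᶜ ≃-trans q s
        })
      +ℂ-cong +ℂ-assoc +ℂ-comm +ℂ-identityˡ -ℂ-cong -ℂ-inverseˡ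
      *ℂ-cong *ℂ-assoc *ℂ-comm *ℂ-identityˡ *ℂ-distribˡ
  }

open CommutativeRing ℂ-commutativeRing public
  using (_≈_; _≉_; _+_; _*_; 0#; 1#)
open Exp (CommutativeRing.semiring ℂ-commutativeRing) public using (_^_)
open Sum (CommutativeRing.semiring ℂ-commutativeRing) public
  using (sum; sum-syntax)
open VectorEquality (CommutativeRing.setoid ℂ-commutativeRing) public
  using (_≋_)

rational : ℚ → ℂ
rational q = fromℚ q +i 0ℝ

------------------------------------------------------------------------
-- Vectors in ℂ^X and matrices in ℂ^{X×X}, for X = Fin n.

Matrix : ℕ → Set
Matrix n = Fin n → Fin n → ℂ

infix  4 _≈ᴹ_
infixl 7 _·_ _⊡_
infixl 6 _⊞_ _⊕_
infixr 7 _⊙_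

_≈ᴹ_ : ∀ {n} → Matrix n → Matrix n → Set
F ≈ᴹ G = ∀ y z → F y z ≈ G y z

0ᴹ : ∀ {n} → Matrix n
0ᴹ _ _ = 0#

_⊞_ : ∀ {n} → Matrix n → Matrix n → Matrix n
(F ⊞ G) y z = F y z + G y z

_⊡_ : ∀ {n} → Matrix n → Matrix n → Matrix n
_⊡_ {n} F G y z = ∑[ w < n ] (F y w * G w z)

_·_ : ∀ {n} → Matrix n → Vector ℂ n → Vector ℂ n
_·_ {n} F v y = ∑[ w < n ] (F y w * v w)

0ⱽ : ∀ {n} → Vector ℂ n
0ⱽ _ = 0#

_⊕_ : ∀ {n} → Vector ℂ n → Vector ℂ n → Vector ℂ n
(u ⊕ v) y = u y + v y

_⊙_ : ∀ {n} → ℂ → Vector ℂ n → Vector ℂ n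
(a ⊙ v) y = a * v y

basis : ∀ {n} → Fin n → Vector ℂ n
basis x y with x Fin.≟ y
... | yes _ = 1#
... | no  _ = 0#

infix 4 _∈Image_

_∈Image_ : ∀ {n} → Vector ℂ n → Matrix n → Set
v ∈Image F = ∃[ u ] v ≋ F · u

LinearlyDependent : ∀ {n} → Vector ℂ n → Vector ℂ n → Set
LinearlyDependent u v =
  ∃₂ λ a b → ¬ (a ≈ 0# × b ≈ 0#) × (a ⊙ u) ⊕ (b ⊙ v) ≋ 0ⱽ

-- F = c₀ J + c₁ G + … + c_d G^{∘d} with c_d ≠ 0, powers being entrywise.
IsHadamardPolynomial : ∀ {n} → ℕ → Matrix n → Matrix n → Set
IsHadamardPolynomial d F G = ∃ λ (c : Vector ℂ (suc d)) →
  c (fromℕ d) ≉ 0# × (∀ y z → F y z ≈ ∑[ l < suc d ] (c l * G y z ^ toℕ l))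

------------------------------------------------------------------------
-- Symmetric association schemes

-- The partition R₀, …, R_D of X × X is given by the function sending
-- (y , z) to the index of the relation containing it.
record SymmetricAssociationScheme (n D : ℕ) : Set where
  field
    R         : Fin n → Fin n → Fin (suc D)
    nonempty  : ∀ i → ∃₂ λ y z → R y z ≡ i
    diagonal  : ∀ y z → R y z ≡ zero ⇔ y ≡ z
    symmetric : ∀ y z → R y z ≡ R z y
    p         : (i j k : Fin (suc D)) → ℕ
    p-count   : ∀ i j y z →
      length (filter (λ w → R y w Fin.≟ i ×-dec R w z Fin.≟ j) (allFin n))
        ≡ p i j (R y z)

module _ {n D : ℕ} (𝒳 : SymmetricAssociationScheme n D) where
  open SymmetricAssociationScheme 𝒳

  A : Fin (suc D) → Matrix n
  A i y z with R y z Fin.≟ i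
  ... | yes _ = 1#
  ... | no  _ = 0#

  -- The Bose–Mesner algebra, i.e. the span of the associate matrices.
  BoseMesner : Matrix n → Set
  BoseMesner F = ∃ λ (c : Vector ℂ (suc D)) →
    ∀ y z → F y z ≈ ∑[ i < suc D ] (c i * A i y z)

  record IsPrimitiveIdempotent (F : Matrix n) : Set where
    field
      member         : BoseMesner F
      idempotent     : F ⊡ F ≈ᴹ F
      nonzero        : ¬ F ≈ᴹ 0ᴹ
      indecomposable : ∀ G H → BoseMesner G → BoseMesner H →
        G ⊡ G ≈ᴹ G → H ⊡ H ≈ᴹ H → G ⊡ H ≈ᴹ 0ᴹ → H ⊡ G ≈ᴹ 0ᴹ →
        F ≈ᴹ G ⊞ H → ¬ (¬ G ≈ᴹ 0ᴹ × ¬ H ≈ᴹ 0ᴹ)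

  record ArePrimitiveIdempotents .{{_ : ℕ.NonZero n}}
                                 (E : Fin (suc D) → Matrix n) : Set where
    field
      primitives : ∀ i → IsPrimitiveIdempotent (E i)
      distinct   : ∀ i j → E i ≈ᴹ E j → i ≡ j
      exhaustive : ∀ F → IsPrimitiveIdempotent F → ∃[ i ] F ≈ᴹ E i
      E₀         : ∀ y z → E zero y z ≈ rational (ℤ.+ 1 ℚ./ n)

  E* : Fin n → Fin (suc D) → Matrix n
  E* x k y z with y Fin.≟ z
  ... | yes _ = A k x y
  ... | no  _ = 0#

  IsCode : (Fin (suc D) → Matrix n) → Vector ℂ n → Set
  IsCode E χ = ¬ (χ ∈Image E zero) × (∀ z → ¬ (χ ∈Image E* z zero))

-- E₁ is quantified as "the E e with toℕ e ≡ 1" because Fin (suc D) has no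
-- such element when D = 0; there are no codes in that case.
IsCometric : ∀ {n D} → (Fin (suc D) → Matrix n) → Set
IsCometric {D = D} E = ∀ (e : Fin (suc D)) → toℕ e ≡ 1 →
  ∀ j → IsHadamardPolynomial (toℕ j) (E j) (E e)

-- Minima and cardinalities of undecidable sets are given as relations.
IsMinimum : (ℕ → Set) → ℕ → Set
IsMinimum P m = P m × (∀ i → P i → m ℕ.≤ i)

HasCardinality : ∀ {m} → (Fin m → Set) → ℕ → Set
HasCardinality {m} P s =
  ∃[ S ] (∀ (i : Fin m) → i ∈ S ⇔ P i) × ∣ S ∣ ≡ s

-- δ = δ*(χ)
IsDualDistance : ∀ {n D} → (Fin (suc D) → Matrix n) → Vector ℂ n → ℕ → Set
IsDualDistance E χ =
  IsMinimum λ d → ∃[ j ] toℕ j ≡ d × j ≢ zero × ¬ (E j · χ ≋ 0ⱽ)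

-- s = s_x(χ)
IsDegree : ∀ {n D} → SymmetricAssociationScheme n D →
           Fin n → Vector ℂ n → ℕ → Set
IsDegree 𝒳 x χ = HasCardinality λ i → i ≢ zero × ¬ (E* 𝒳 x i · χ ≋ 0ⱽ)

IsRelativeDesign : ∀ {n D} → (Fin (suc D) → Matrix n) →
                   Fin n → ℤ → Vector ℂ n → Set
IsRelativeDesign E x t ψ = ∀ j → 1 ℕ.≤ toℕ j → ℤ.+ toℕ j ℤ.≤ t →
  LinearlyDependent (E j · ψ) (E j · basis x)

module Submission where

-- Write G = E₁ with entries θ(R(y,z)).  The θ i are pairwise distinct, for otherwise
-- E_D would lie in the span of E₀, …, E_{D-1}.  For a matrix F let Δ(F) be the
-- diagonal matrix formed from row x of F.  Since E_j, E_l and E_m are real symmetric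
-- idempotents, the squared Frobenius norms of E_j Δ(E_l) E_m, summed over x, give the
-- sum of all entries of E_j ∘ E_l ∘ E_m, which vanishes for m > j + l because E_j ∘ E_l
-- is an entrywise polynomial of degree j + l in G.  Let f be the polynomial with
-- roots θ i for i in the support of χ other than 0 and k.  Up to a multiple of x̂,
-- Δ(f(G)) χ is a nonzero multiple of E*_k χ.  Expanding χ in the spaces E_m V, the
-- terms with m ≥ δ* are annihilated by E_j Δ(f(G)), those with 0 < m < δ* are zero, and
-- the term m = 0 contributes a multiple of E_j x̂.
--
-- Equality of Cauchy reals is stable under double negation but not decidable, so all
-- divisions above are performed under a double negation.  Only the coefficient itself
-- has to be exhibited; it is read off at x, where E_j x̂ has the entry E_j(x,x),
-- which is effectively invertible because it is at least 1/n.

open import Defs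
open import Algebra.Bundles using (CommutativeRing; RingWithoutOne)
import Algebra.Construct.Pointwise as Pointwise
import Algebra.Properties.AbelianGroup as AbelianGroupProperties
import Algebra.Properties.Group as GroupProperties
import Algebra.Properties.Ring as RingProperties
import Algebra.Properties.RingWithoutOne as RingWithoutOneProperties
import Algebra.Properties.Semiring.Exp as Exp
import Algebra.Properties.Semiring.Mult as Mult
import Algebra.Properties.Semiring.Sum as Sum
import Algebra.Solver.Ring.NaturalCoefficients.Default as SemiringSolver
open import Data.Fin.Base using (Fin; zero; suc; toℕ; fromℕ; fromℕ<; inject₁; punchIn; punchOut)
import Data.Fin.Properties as Fin
open import Data.Fin.Subset using (Subset; inside; outside; ∣_∣; _-_)
  renaming (_∈_ to _∈ˢ_; _∉_ to _∉ˢ_)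
import Data.Fin.Subset.Properties as Subset
open import Data.Integer.Base using (+_) renaming (_≤_ to _≤ℤ_; _-_ to _-ℤ_)
import Data.Integer.Properties as ℤ
open import Data.List.Base using (List; []; _∷_; length; filter; map; tabulate)
open import Data.List.Membership.Propositional using (_∈_)
open import Data.List.Membership.Propositional.Properties using (∈-map⁺)
import Data.List.Properties as List
open import Data.List.Relation.Unary.All as All using (All; []; _∷_)
import Data.List.Relation.Unary.All.Properties as All
open import Data.List.Relation.Unary.Any as Any using (Any; here; there)
import Data.List.Relation.Unary.Any.Properties as Any
open import Data.Nat.Base as ℕ using (ℕ; zero; suc; _≤_; _<_; s≤s; NonZero)
import Data.Nat.Properties as ℕ
open import Data.Product.Base using (∃; ∃-syntax; _×_; _,_; proj₁; proj₂)
open import Data.Rational.Base as ℚ using (ℚ; 0ℚ; 1ℚ; ½)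
import Data.Rational.Properties as ℚ
open import Data.Sum.Base using (inj₁; inj₂)
open import Data.Vec.Base as Vec using ([]; _∷_)
open import Data.Vec.Functional using (Vector)
open import Effect.Monad using (RawMonad)
open import Function.Base using (_∘_; id)
open import Function.Bundles using (Equivalence)
open import Level using (0ℓ)
open import Relation.Binary.PropositionalEquality as ≡
  using (_≡_; _≢_; cong; cong₂; subst; subst₂)
import Relation.Binary.Reasoning.Setoid as SetoidReasoning
open import Relation.Nullary.Decidable.Core using (Dec; yes; no; _×-dec_; dec⇒maybe)
open import Relation.Nullary.Negation using (¬_; contradiction; ¬¬-Monad)
open import Relation.Unary using (Decidable)
open import Tactic.RingSolver using (solve-∀)
import Tactic.RingSolver.Core.AlmostCommutativeRing as ACR

module 𝐑 where
  open CommutativeRing ℝ-commutativeRing public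
  open RingProperties ring public using
    (-‿distribˡ-*; -‿distribʳ-*; -‿+-comm; -0#≈0#; -‿involutive)

module 𝐂 where
  open CommutativeRing ℂ-commutativeRing public
  open RingProperties ring public using
    (-‿distribˡ-*; -‿involutive; x∙y⁻¹≈ε⇒x≈y; x≈y⇒x∙y⁻¹≈ε)

open AbelianGroupProperties ℤ.+-0-abelianGroup using (//-rightDividesˡ)
open Exp 𝐂.semiring using (^-homo-*)
open Mult 𝐂.semiring using () renaming (_×_ to _×ⁿ_)
open SemiringSolver 𝐂.commutativeSemiring using (solve; _:=_; _:*_; _:+_; con)
open Sum 𝐂.semiring using
  (sum-cong-≋; sum-replicate-zero; sum-init-last; ∑-distrib-+; ∑-comm; *-distribˡ-sum; *-distribʳ-sum)
open 𝐂 using (refl; sym; trans; -_)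

-- Cauchy reals

private
  ℚ-ring = ACR.fromCommutativeRing ℚ.+-*-commutativeRing
    (λ q → dec⇒maybe (0ℚ ℚ.≟ q))

split-difference : ∀ a b → a ≡ (a ℚ.- b) ℚ.+ b
split-difference = solve-∀ ℚ-ring

swap-difference : ∀ a b → ℚ.- (a ℚ.- b) ≡ b ℚ.- a
swap-difference = solve-∀ ℚ-ring

minus-zero : ∀ a → a ℚ.- 0ℚ ≡ a
minus-zero = solve-∀ ℚ-ring

difference-of-inverses : ∀ r s a b →
  r ℚ.* (s ℚ.* (b ℚ.- a)) ≡ r ℚ.* (s ℚ.* b) ℚ.- s ℚ.* (r ℚ.* a)
difference-of-inverses = solve-∀ ℚ-ring

regroup : ∀ a b → 1ℚ ℚ.+ a ≡ (a ℚ.- (b ℚ.- 1ℚ)) ℚ.+ b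
regroup = solve-∀ ℚ-ring

neg-square : ∀ p → (ℚ.- p) ℚ.* (ℚ.- p) ≡ p ℚ.* p
neg-square = solve-∀ ℚ-ring

p≤∣p∣ : ∀ p → p ℚ.≤ ℚ.∣ p ∣
p≤∣p∣ p with ℚ.≤-total 0ℚ p
... | inj₁ p≥0 = ℚ.≤-reflexive (≡.sym (ℚ.0≤p⇒∣p∣≡p p≥0))
... | inj₂ p≤0 = ℚ.≤-trans p≤0 (ℚ.0≤∣p∣ p)

half+half : ∀ ε → ½ ℚ.* ε ℚ.+ ½ ℚ.* ε ≡ ε
half+half ε = ≡.trans (≡.sym (ℚ.*-distribʳ-+ ε ½ ½)) (ℚ.*-identityˡ ε)

*-positive : ∀ {p q} → 0ℚ ℚ.< p → 0ℚ ℚ.< q → 0ℚ ℚ.< p ℚ.* q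
*-positive {p} {q} p>0 q>0 = ℚ.positive⁻¹ (p ℚ.* q)
  {{ℚ.pos*pos⇒pos p {{ℚ.positive p>0}} q {{ℚ.positive q>0}}}}

*-nonNegative : ∀ {p q} → 0ℚ ℚ.≤ p → 0ℚ ℚ.≤ q → 0ℚ ℚ.≤ p ℚ.* q
*-nonNegative {p} {q} p≥0 q≥0 = ℚ.nonNegative⁻¹ (p ℚ.* q)
  {{ℚ.nonNeg*nonNeg⇒nonNeg p {{ℚ.nonNegative p≥0}} q {{ℚ.nonNegative q≥0}}}}

square-nonNegative : ∀ p → 0ℚ ℚ.≤ p ℚ.* p
square-nonNegative p with ℚ.≤-total 0ℚ p
... | inj₁ p≥0 = *-nonNegative p≥0 p≥0
... | inj₂ p≤0 = subst (0ℚ ℚ.≤_) (neg-square p)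
  (*-nonNegative (ℚ.neg-antimono-≤ p≤0) (ℚ.neg-antimono-≤ p≤0))

half-positive : ∀ {ε} → 0ℚ ℚ.< ε → 0ℚ ℚ.< ½ ℚ.* ε
half-positive = *-positive (ℚ.positive⁻¹ ½)

half-< : ∀ {ε} → 0ℚ ℚ.< ε → ½ ℚ.* ε ℚ.< ε
half-< {ε} ε>0 = subst₂ ℚ._<_ (ℚ.+-identityʳ _) (half+half ε)
  (ℚ.+-monoʳ-< (½ ℚ.* ε) (half-positive ε>0))

∣a∣≤∣a-b∣+∣b∣ : ∀ a b → ℚ.∣ a ∣ ℚ.≤ ℚ.∣ a ℚ.- b ∣ ℚ.+ ℚ.∣ b ∣
∣a∣≤∣a-b∣+∣b∣ a b = subst (λ q → ℚ.∣ q ∣ ℚ.≤ ℚ.∣ a ℚ.- b ∣ ℚ.+ ℚ.∣ b ∣) (≡.sym (split-difference a b))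
  (ℚ.∣p+q∣≤∣p∣+∣q∣ (a ℚ.- b) b)

∣-∣-swap : ∀ a b → ℚ.∣ a ℚ.- b ∣ ≡ ℚ.∣ b ℚ.- a ∣
∣-∣-swap a b = ≡.trans (≡.sym (ℚ.∣-p∣≡∣p∣ (a ℚ.- b))) (cong ℚ.∣_∣ (swap-difference a b))

far-from-zero : ∀ {ε} a b → ε ℚ.≤ ℚ.∣ a ∣ → ℚ.∣ b ℚ.- a ∣ ℚ.< ½ ℚ.* ε → ½ ℚ.* ε ℚ.≤ ℚ.∣ b ∣
far-from-zero {ε} a b ε≤a near = ℚ.≮⇒≥ λ small → ℚ.<-irrefl ≡.refl
  (ℚ.≤-<-trans (ℚ.≤-trans ε≤a (∣a∣≤∣a-b∣+∣b∣ a b))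
    (subst₂ ℚ._<_ (cong (ℚ._+ ℚ.∣ b ∣) (∣-∣-swap b a)) (half+half ε)
      (ℚ.+-mono-< near small)))

-- The default value 0 makes the termwise inverse of a sequence total; a sequence bounded away from
-- zero in the tail may still vanish at early indices.
inv₀ : ℚ → ℚ
inv₀ p with p ℚ.≟ 0ℚ
... | yes _   = 0ℚ
... | no p≢0 = ℚ.1/_ p {{ℚ.≢-nonZero p≢0}}

inv₀-inverseˡ : ∀ {p} → p ≢ 0ℚ → inv₀ p ℚ.* p ≡ 1ℚ
inv₀-inverseˡ {p} p≢0 with p ℚ.≟ 0ℚ
... | yes p≡0 = contradiction p≡0 p≢0
... | no  p≢0 = ℚ.*-inverseˡ p {{ℚ.≢-nonZero p≢0}}

-- Nonvanishing with a witness: an eventual rational lower bound, from which an inverse can be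
-- computed.
Apart : ℝ → Set
Apart x = ∃[ ε ] 0ℚ ℚ.< ε × ∃[ N ] ∀ n → N ℕ.≤ n → ε ℚ.≤ ℚ.∣ seq x n ∣

-- One approximation decides. At a Cauchy index for ε/4, either the term is below ε/2 in absolute
-- value and the tail stays below ε, or the tail is at least ε/4 in absolute value, which
-- contradicts the assumption.
¬apart⇒≃0 : ∀ x → ¬ Apart x → x ≃ 0ℝ
¬apart⇒≃0 x ¬apart = mk≃ λ ε ε>0 → close-to-zero ε ε>0
  where
  close-to-zero : ∀ ε → 0ℚ ℚ.< ε →
    ∃[ N ] ∀ n → N ℕ.≤ n → ℚ.∣ seq x n ℚ.- 0ℚ ∣ ℚ.< ε
  close-to-zero ε ε>0 with cauchy x (½ ℚ.* (½ ℚ.* ε)) (half-positive (half-positive ε>0))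
  ... | N , h with ℚ.∣ seq x N ∣ ℚ.<? ½ ℚ.* ε
  ... | yes small = N , λ n N≤n →
    subst (λ q → ℚ.∣ q ∣ ℚ.< ε) (≡.sym (minus-zero (seq x n)))
      (ℚ.≤-<-trans (∣a∣≤∣a-b∣+∣b∣ (seq x n) (seq x N))
        (subst (_ ℚ.<_) (half+half ε)
          (ℚ.+-mono-< (ℚ.<-trans (h n N N≤n ℕ.≤-refl) (half-< (half-positive ε>0))) small)))
  ... | no large = contradiction
    (½ ℚ.* (½ ℚ.* ε) , half-positive (half-positive ε>0) , N , λ n N≤n →
      far-from-zero (seq x N) (seq x n) (ℚ.≮⇒≥ large) (h n N N≤n ℕ.≤-refl))
    ¬apart

apart⇒≄0 : ∀ x → Apart x → ¬ (x ≃ 0ℝ)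
apart⇒≄0 x (ε , ε>0 , N , h) x≃0 =
  let M , h′ = close x≃0 ε ε>0
      K = N ℕ.⊔ M
  in ℚ.<-irrefl ≡.refl (ℚ.≤-<-trans (h K (ℕ.m≤m⊔n N M))
       (subst (λ q → ℚ.∣ q ∣ ℚ.< ε) (minus-zero (seq x K)) (h′ K (ℕ.m≤n⊔m N M))))

opaque
  unfolding _+ℝ_

  seq-+ : ∀ x y n → seq (x +ℝ y) n ≡ seq x n ℚ.+ seq y n
  seq-+ x y n = ≡.refl

  seq-* : ∀ x y n → seq (x *ℝ y) n ≡ seq x n ℚ.* seq y n
  seq-* x y n = ≡.refl

  seq-neg : ∀ x n → seq (-ℝ x) n ≡ ℚ.- seq x n
  seq-neg x n = ≡.refl

eventually-≡⇒≃ : ∀ {x y} N → (∀ n → N ℕ.≤ n → seq x n ≡ seq y n) → x ≃ y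
eventually-≡⇒≃ {x} {y} N eq = mk≃ λ ε ε>0 → N , λ n N≤n →
  subst (λ q → ℚ.∣ q ∣ ℚ.< ε)
    (≡.sym (≡.trans (cong (ℚ._- seq y n) (eq n N≤n)) (ℚ.+-inverseʳ (seq y n)))) ε>0

apart⇒invertible : ∀ x → Apart x → ∃[ r ] r *ℝ x ≃ 1ℝ
apart⇒invertible x (ε , ε>0 , N , h) = mkℝ r r-cauchy , r*x≃1
  where
  instance
    ε-positive : ℚ.Positive ε
    ε-positive = ℚ.positive ε>0
    ε-nonZero : ℚ.NonZero ε
    ε-nonZero = ℚ.pos⇒nonZero ε

  B : ℚ
  B = ℚ.1/ ε

  r : ℕ → ℚ
  r n = inv₀ (seq x n)

  r-inverse : ∀ n → N ℕ.≤ n → r n ℚ.* seq x n ≡ 1ℚ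
  r-inverse n N≤n = inv₀-inverseˡ λ xₙ≡0 → ℚ.<-irrefl ≡.refl
    (ℚ.<-≤-trans ε>0 (subst (λ q → ε ℚ.≤ ℚ.∣ q ∣) xₙ≡0 (h n N≤n)))

  r-bounded : ∀ n → N ℕ.≤ n → ℚ.∣ r n ∣ ℚ.≤ B
  r-bounded n N≤n = ℚ.*-cancelʳ-≤-pos ε
    (subst (ℚ.∣ r n ∣ ℚ.* ε ℚ.≤_)
      (≡.trans (≡.sym (ℚ.∣p*q∣≡∣p∣*∣q∣ (r n) (seq x n)))
        (≡.trans (cong ℚ.∣_∣ (r-inverse n N≤n)) (≡.sym (ℚ.*-inverseˡ ε))))
      (ℚ.*-monoˡ-≤-nonNeg ℚ.∣ r n ∣ {{ℚ.∣-∣-nonNeg (r n)}} (h n N≤n)))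

  r-cauchy : IsCauchy r
  r-cauchy δ δ>0 =
    -- The difference of two inverses is bounded by ε⁻² times the difference of the terms, so the
    -- tolerance ε²δ leaves δ.
    let M , near = cauchy x (ε ℚ.* (ε ℚ.* δ)) (*-positive ε>0 (*-positive ε>0 δ>0))
    in N ℕ.⊔ M , λ m n m≥ n≥ → bound m n
         (ℕ.m⊔n≤o⇒m≤o N M m≥) (ℕ.m⊔n≤o⇒m≤o N M n≥)
         (near n m (ℕ.m⊔n≤o⇒n≤o N M n≥) (ℕ.m⊔n≤o⇒n≤o N M m≥))
    where
    cancel : ∀ q → B ℚ.* (ε ℚ.* q) ≡ q
    cancel q = ≡.trans (≡.sym (ℚ.*-assoc B ε q))
      (≡.trans (cong (ℚ._* q) (ℚ.*-inverseˡ ε)) (ℚ.*-identityˡ q))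

    shape : ∀ m n → N ℕ.≤ m → N ℕ.≤ n →
      ℚ.∣ r m ℚ.- r n ∣ ≡ ℚ.∣ r m ∣ ℚ.* (ℚ.∣ r n ∣ ℚ.* ℚ.∣ seq x n ℚ.- seq x m ∣)
    shape m n N≤m N≤n = ≡.trans
      (cong ℚ.∣_∣ (≡.sym (≡.trans
        (difference-of-inverses (r m) (r n) (seq x m) (seq x n))
        (cong₂ ℚ._-_
          (≡.trans (cong (r m ℚ.*_) (r-inverse n N≤n)) (ℚ.*-identityʳ (r m)))
          (≡.trans (cong (r n ℚ.*_) (r-inverse m N≤m)) (ℚ.*-identityʳ (r n)))))))
      (≡.trans (ℚ.∣p*q∣≡∣p∣*∣q∣ (r m) _)
        (cong (ℚ.∣ r m ∣ ℚ.*_) (ℚ.∣p*q∣≡∣p∣*∣q∣ (r n) _)))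


    bound : ∀ m n → N ℕ.≤ m → N ℕ.≤ n →
      ℚ.∣ seq x n ℚ.- seq x m ∣ ℚ.< ε ℚ.* (ε ℚ.* δ) → ℚ.∣ r m ℚ.- r n ∣ ℚ.< δ
    bound m n N≤m N≤n near = subst₂ ℚ._<_ (≡.sym (shape m n N≤m N≤n))
      (≡.trans (cong (B ℚ.*_) (cancel (ε ℚ.* δ))) (cancel δ))
      (ℚ.≤-<-trans
        (ℚ.≤-trans
          (ℚ.*-monoʳ-≤-nonNeg _
            {{ℚ.nonNegative (*-nonNegative (ℚ.0≤∣p∣ (r n)) (ℚ.0≤∣p∣ (seq x n ℚ.- seq x m)))}}
            (r-bounded m N≤m))
          (ℚ.*-monoˡ-≤-nonNeg B {{ℚ.pos⇒nonNeg B {{ℚ.1/pos⇒pos ε}}}}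
            (ℚ.*-monoʳ-≤-nonNeg ℚ.∣ seq x n ℚ.- seq x m ∣
              {{ℚ.∣-∣-nonNeg (seq x n ℚ.- seq x m)}} (r-bounded n N≤n))))
        (ℚ.*-monoʳ-<-pos B {{ℚ.1/pos⇒pos ε}} (ℚ.*-monoʳ-<-pos B {{ℚ.1/pos⇒pos ε}} near)))

  r*x≃1 : mkℝ r r-cauchy *ℝ x ≃ 1ℝ
  r*x≃1 = eventually-≡⇒≃ N λ n N≤n →
    ≡.trans (seq-* (mkℝ r r-cauchy) x n) (r-inverse n N≤n)

apart-stable : ∀ x ε → 0ℚ ℚ.< ε →
  ¬ ¬ (∃[ N ] ∀ n → N ℕ.≤ n → ε ℚ.≤ ℚ.∣ seq x n ∣) → Apart x
apart-stable x ε ε>0 ¬¬large =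
  let N , h = cauchy x (½ ℚ.* (½ ℚ.* ε)) (half-positive (half-positive ε>0))
      large : ½ ℚ.* ε ℚ.≤ ℚ.∣ seq x N ∣
      large = ℚ.≮⇒≥ λ small → ¬¬large λ (M , large) →
        let K = N ℕ.⊔ M in
        ℚ.<-irrefl ≡.refl (ℚ.≤-<-trans
          (far-from-zero (seq x K) (seq x N) (large K (ℕ.m≤n⊔m N M))
            (ℚ.<-trans (h N K ℕ.≤-refl (ℕ.m≤m⊔n N M)) (half-< (half-positive ε>0))))
          small)
  in ½ ℚ.* (½ ℚ.* ε) , half-positive (half-positive ε>0) , N , λ n N≤n →
     far-from-zero (seq x N) (seq x n) large (h n N N≤n ℕ.≤-refl)

-- A property of the chosen sequence, not of its class modulo `≃`; `NonNegative` below asks only for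
-- some representative of this kind.
Nonnegative : ℝ → Set
Nonnegative x = ∀ n → 0ℚ ℚ.≤ seq x n

+ℝ-nonnegative : ∀ {x y} → Nonnegative x → Nonnegative y → Nonnegative (x +ℝ y)
+ℝ-nonnegative {x} {y} x≥0 y≥0 n =
  subst (0ℚ ℚ.≤_) (≡.sym (seq-+ x y n)) (ℚ.+-mono-≤ (x≥0 n) (y≥0 n))

*ℝ-nonnegative : ∀ {x y} → Nonnegative x → Nonnegative y → Nonnegative (x *ℝ y)
*ℝ-nonnegative {x} {y} x≥0 y≥0 n =
  subst (0ℚ ℚ.≤_) (≡.sym (seq-* x y n)) (*-nonNegative (x≥0 n) (y≥0 n))

squareℝ-nonnegative : ∀ x → Nonnegative (x *ℝ x)
squareℝ-nonnegative x n = subst (0ℚ ℚ.≤_) (≡.sym (seq-* x x n)) (square-nonNegative (seq x n))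

nonnegative-sum-zero : ∀ {x y} → Nonnegative x → Nonnegative y → x +ℝ y ≃ 0ℝ → x ≃ 0ℝ
nonnegative-sum-zero {x} {y} x≥0 y≥0 x+y≃0 = mk≃ λ ε ε>0 →
  let N , h = close x+y≃0 ε ε>0 in N , λ n N≤n →
  ℚ.≤-<-trans (bound n) (h n N≤n)
  where
  bound : ∀ n → ℚ.∣ seq x n ℚ.- 0ℚ ∣ ℚ.≤ ℚ.∣ seq (x +ℝ y) n ℚ.- 0ℚ ∣
  bound n = subst₂ ℚ._≤_
    (≡.sym (≡.trans (cong ℚ.∣_∣ (minus-zero (seq x n))) (ℚ.0≤p⇒∣p∣≡p (x≥0 n))))
    (≡.sym (≡.trans (cong ℚ.∣_∣ (minus-zero (seq (x +ℝ y) n)))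
                    (ℚ.0≤p⇒∣p∣≡p (+ℝ-nonnegative {x} {y} x≥0 y≥0 n))))
    (subst₂ ℚ._≤_ (ℚ.+-identityʳ (seq x n)) (≡.sym (seq-+ x y n))
      (ℚ.+-monoʳ-≤ (seq x n) (y≥0 n)))

apart⇒square-sum-apart : ∀ x y → Apart x → Apart (x *ℝ x +ℝ y *ℝ y)
apart⇒square-sum-apart x y (ε , ε>0 , N , h) =
  ε ℚ.* ε , *-positive ε>0 ε>0 , N , λ n N≤n → begin
    ε ℚ.* ε
      ≤⟨ ℚ.*-monoʳ-≤-nonNeg ε {{ℚ.nonNegative (ℚ.<⇒≤ ε>0)}} (h n N≤n) ⟩
    ℚ.∣ seq x n ∣ ℚ.* ε
      ≤⟨ ℚ.*-monoˡ-≤-nonNeg ℚ.∣ seq x n ∣ {{ℚ.∣-∣-nonNeg (seq x n)}} (h n N≤n) ⟩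
    ℚ.∣ seq x n ∣ ℚ.* ℚ.∣ seq x n ∣
      ≡⟨ ℚ.∣p*q∣≡∣p∣*∣q∣ (seq x n) (seq x n) ⟨
    ℚ.∣ seq x n ℚ.* seq x n ∣
      ≡⟨ ℚ.0≤p⇒∣p∣≡p (square-nonNegative (seq x n)) ⟩
    seq x n ℚ.* seq x n
      ≡⟨ ℚ.+-identityʳ _ ⟨
    seq x n ℚ.* seq x n ℚ.+ 0ℚ
      ≤⟨ ℚ.+-monoʳ-≤ (seq x n ℚ.* seq x n) (square-nonNegative (seq y n)) ⟩
    seq x n ℚ.* seq x n ℚ.+ seq y n ℚ.* seq y n
      ≡⟨ cong₂ ℚ._+_ (seq-* x x n) (seq-* y y n) ⟨
    seq (x *ℝ x) n ℚ.+ seq (y *ℝ y) n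
      ≡⟨ seq-+ (x *ℝ x) (y *ℝ y) n ⟨
    seq (x *ℝ x +ℝ y *ℝ y) n
      ≡⟨ ℚ.0≤p⇒∣p∣≡p (+ℝ-nonnegative {x *ℝ x} {y *ℝ y}
           (squareℝ-nonnegative x) (squareℝ-nonnegative y) n) ⟨
    ℚ.∣ seq (x *ℝ x +ℝ y *ℝ y) n ∣ ∎
  where open ℚ.≤-Reasoning

square-sum-zero : ∀ x y → x *ℝ x +ℝ y *ℝ y ≃ 0ℝ → x ≃ 0ℝ
square-sum-zero x y p = ¬apart⇒≃0 x λ apart →
  apart⇒≄0 _ (apart⇒square-sum-apart x y apart) p

-- Complex numbers

ofℝ : ℝ → ℂ
ofℝ x = x +i 0ℝ

conj : ℂ → ℂ
conj z = re z +i -ℝ im z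

norm² : ℂ → ℝ
norm² z = re z *ℝ re z +ℝ im z *ℝ im z

conj-cong : ∀ {z w} → z ≈ w → conj z ≈ conj w
conj-cong (p ,ᶜ q) = p ,ᶜ 𝐑.-‿cong q

ofℝ-cong : ∀ {x y} → x ≃ y → ofℝ x ≈ ofℝ y
ofℝ-cong p = p ,ᶜ 𝐑.refl

conj-involutive : ∀ z → conj (conj z) ≈ z
conj-involutive z = 𝐑.refl ,ᶜ 𝐑.-‿involutive (im z)

conj-0 : conj 0# ≈ 0#
conj-0 = 𝐑.refl ,ᶜ 𝐑.-0#≈0#

opaque
  unfolding _+ℂ_

  re-+ : ∀ z w → re (z + w) ≡ re z +ℝ re w
  re-+ z w = ≡.refl

  re-neg : ∀ z → re (- z) ≡ -ℝ re z
  re-neg z = ≡.refl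

  ofℝ-+ : ∀ x y → ofℝ (x +ℝ y) ≈ ofℝ x + ofℝ y
  ofℝ-+ x y = 𝐑.refl ,ᶜ 𝐑.sym (𝐑.+-identityˡ 0ℝ)

  ofℝ-* : ∀ x y → ofℝ (x *ℝ y) ≈ ofℝ x * ofℝ y
  ofℝ-* x y =
    𝐑.sym (𝐑.trans (𝐑.+-congˡ (𝐑.trans (𝐑.-‿cong (𝐑.zeroˡ 0ℝ)) 𝐑.-0#≈0#)) (𝐑.+-identityʳ _)) ,ᶜ
    𝐑.sym (𝐑.trans (𝐑.+-cong (𝐑.zeroʳ x) (𝐑.zeroˡ y)) (𝐑.+-identityʳ 0ℝ))

  conj-+ : ∀ z w → conj (z + w) ≈ conj z + conj w
  conj-+ z w = 𝐑.refl ,ᶜ 𝐑.sym (𝐑.-‿+-comm (im z) (im w))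

  conj-* : ∀ z w → conj (z * w) ≈ conj z * conj w
  conj-* (a +i b) (c +i d) =
    𝐑.+-congˡ (𝐑.-‿cong (𝐑.sym (𝐑.trans (𝐑.sym (𝐑.-‿distribˡ-* b (-ℝ d)))
      (𝐑.trans (𝐑.-‿cong (𝐑.sym (𝐑.-‿distribʳ-* b d))) (𝐑.-‿involutive _))))) ,ᶜ
    𝐑.trans (𝐑.sym (𝐑.-‿+-comm _ _))
      (𝐑.+-cong (𝐑.-‿distribʳ-* a d) (𝐑.-‿distribˡ-* b c))

  conj-neg : ∀ z → conj (- z) ≈ - conj z
  conj-neg z = refl

  *-conj : ∀ z → z * conj z ≈ ofℝ (norm² z)
  *-conj (a +i b) =
    𝐑.+-congˡ (𝐑.trans (𝐑.-‿cong (𝐑.sym (𝐑.-‿distribʳ-* b b))) (𝐑.-‿involutive _)) ,ᶜ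
    𝐑.trans (𝐑.+-cong (𝐑.sym (𝐑.-‿distribʳ-* a b)) (𝐑.*-comm b a)) (𝐑.-‿inverseˡ _)

norm²-zero : ∀ z → norm² z ≃ 0ℝ → z ≈ 0#
norm²-zero z p = square-sum-zero (re z) (im z) p ,ᶜ
  square-sum-zero (im z) (re z) (𝐑.trans (𝐑.+-comm _ _) p)

Invertible : ℂ → Set
Invertible z = ∃[ r ] r * z ≈ 1#

norm²-apart⇒invertible : ∀ z → Apart (norm² z) → Invertible z
norm²-apart⇒invertible z apart =
  let s , s*norm≃1 = apart⇒invertible (norm² z) apart
  in ofℝ s * conj z , (begin
    ofℝ s * conj z * z     ≈⟨ 𝐂.*-assoc _ _ _ ⟩
    ofℝ s * (conj z * z)   ≈⟨ 𝐂.*-congˡ (trans (𝐂.*-comm _ _) (*-conj z)) ⟩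
    ofℝ s * ofℝ (norm² z)  ≈⟨ ofℝ-* s (norm² z) ⟨
    ofℝ (s *ℝ norm² z)     ≈⟨ ofℝ-cong s*norm≃1 ⟩
    1#                     ∎)
  where open SetoidReasoning 𝐂.setoid

-- If z has no inverse, then |z|² is not apart from zero, hence is zero. Apartness itself cannot be
-- extracted from `z ≉ 0#`, which is why the inverse stays under a double negation.
≉0⇒¬¬invertible : ∀ z → z ≉ 0# → ¬ ¬ Invertible z
≉0⇒¬¬invertible z z≉0 ¬invertible = z≉0 (norm²-zero z (¬apart⇒≃0 _ λ apart →
  ¬invertible (norm²-apart⇒invertible z apart)))

≈0-stable : ∀ z → ¬ ¬ (z ≈ 0#) → z ≈ 0#
≈0-stable z ¬¬z≈0 = stable re re≃ ,ᶜ stable im im≃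
  where
  stable : ∀ (f : ℂ → ℝ) → (z ≈ 0# → f z ≃ 0ℝ) → f z ≃ 0ℝ
  stable f g = ¬apart⇒≃0 _ λ apart → ¬¬z≈0 λ z≈0 → apart⇒≄0 _ apart (g z≈0)

≈-stable : ∀ z w → ¬ ¬ (z ≈ w) → z ≈ w
≈-stable z w ¬¬z≈w = 𝐂.x∙y⁻¹≈ε⇒x≈y z w
  (≈0-stable _ λ ¬p → ¬¬z≈w λ z≈w → ¬p (𝐂.x≈y⇒x∙y⁻¹≈ε z≈w))

1≉0 : 1# ≉ 0#
1≉0 (p ,ᶜ _) = apart⇒≄0 1ℝ
  (1ℚ , ℚ.positive⁻¹ 1ℚ , 0 , λ _ _ → ℚ.≤-refl) p

record NonNegative (z : ℂ) : Set where
  constructor nonNeg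
  field
    representative : ℝ
    nonnegative    : Nonnegative representative
    z≈             : z ≈ ofℝ representative

nonNeg-cong : ∀ {z w} → z ≈ w → NonNegative z → NonNegative w
nonNeg-cong z≈w (nonNeg x x≥0 z≈x) = nonNeg x x≥0 (trans (sym z≈w) z≈x)

nonNeg-0 : NonNegative 0#
nonNeg-0 = nonNeg 0ℝ (λ _ → ℚ.≤-refl) refl

nonNeg-1 : NonNegative 1#
nonNeg-1 = nonNeg 1ℝ (λ _ → ℚ.nonNegative⁻¹ 1ℚ) refl

nonNeg-+ : ∀ {z w} → NonNegative z → NonNegative w → NonNegative (z + w)
nonNeg-+ (nonNeg x x≥0 z≈x) (nonNeg y y≥0 w≈y) =
  nonNeg (x +ℝ y) (+ℝ-nonnegative {x} {y} x≥0 y≥0)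
    (trans (𝐂.+-cong z≈x w≈y) (sym (ofℝ-+ x y)))

nonNeg-* : ∀ {z w} → NonNegative z → NonNegative w → NonNegative (z * w)
nonNeg-* (nonNeg x x≥0 z≈x) (nonNeg y y≥0 w≈y) =
  nonNeg (x *ℝ y) (*ℝ-nonnegative {x} {y} x≥0 y≥0)
    (trans (𝐂.*-cong z≈x w≈y) (sym (ofℝ-* x y)))

nonNeg-*-conj : ∀ z → NonNegative (z * conj z)
nonNeg-*-conj z = nonNeg (norm² z)
  (+ℝ-nonnegative {re z *ℝ re z} (squareℝ-nonnegative (re z)) (squareℝ-nonnegative (im z)))
  (*-conj z)

nonNeg-sum : ∀ {n} (v : Vector ℂ n) → (∀ i → NonNegative (v i)) → NonNegative (sum v)
nonNeg-sum {zero}  v v≥0 = nonNeg-0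
nonNeg-sum {suc n} v v≥0 = nonNeg-+ (v≥0 zero) (nonNeg-sum (λ i → v (suc i)) (λ i → v≥0 (suc i)))

nonNeg-+-zero : ∀ {z w} → NonNegative z → NonNegative w → z + w ≈ 0# → z ≈ 0#
nonNeg-+-zero (nonNeg x x≥0 z≈x) (nonNeg y y≥0 w≈y) z+w≈0 =
  trans z≈x (ofℝ-cong (nonnegative-sum-zero x≥0 y≥0
    (re≃ (trans (ofℝ-+ x y) (trans (𝐂.+-cong (sym z≈x) (sym w≈y)) z+w≈0)))))

nonNeg-sum-zero : ∀ {n} (v : Vector ℂ n) → (∀ i → NonNegative (v i)) → sum v ≈ 0# → ∀ i → v i ≈ 0#
nonNeg-sum-zero v v≥0 p zero =
  nonNeg-+-zero (v≥0 zero) (nonNeg-sum (λ i → v (suc i)) (λ i → v≥0 (suc i))) p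
nonNeg-sum-zero v v≥0 p (suc i) =
  nonNeg-sum-zero (λ i → v (suc i)) (λ i → v≥0 (suc i))
    (nonNeg-+-zero (nonNeg-sum (λ i → v (suc i)) (λ i → v≥0 (suc i))) (v≥0 zero)
      (trans (𝐂.+-comm _ _) p)) i

*-conj-zero : ∀ z → z * conj z ≈ 0# → z ≈ 0#
*-conj-zero z p = norm²-zero z (re≃ (trans (sym (*-conj z)) p))

-- A bound of the form z ≥ 1 known only up to double negation still yields an
-- inverse, because "z is eventually at least ½" can be tested on one approximation.
¬¬≥1⇒invertible : ∀ z → ¬ ¬ NonNegative (z + - 1#) → Invertible z
¬¬≥1⇒invertible z ¬¬z≥1 = norm²-apart⇒invertible z
  (apart⇒square-sum-apart (re z) (im z)
    (apart-stable (re z) ½ (ℚ.positive⁻¹ ½) λ ¬large → ¬¬z≥1 λ z≥1 → ¬large (large z≥1)))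
  where
  large : NonNegative (z + - 1#) → ∃[ N ] ∀ n → N ℕ.≤ n → ½ ℚ.≤ ℚ.∣ seq (re z) n ∣
  large (nonNeg x x≥0 z-1≈x) =
    let N , h = close (re≃ z-1≈x) ½ (ℚ.positive⁻¹ ½) in
    N , λ n N≤n → ℚ.≮⇒≥ λ small → ℚ.<-irrefl ≡.refl (begin-strict
      1ℚ
        ≡⟨ ℚ.+-identityʳ 1ℚ ⟨
      1ℚ ℚ.+ 0ℚ
        ≤⟨ ℚ.+-monoʳ-≤ 1ℚ (x≥0 n) ⟩
      1ℚ ℚ.+ seq x n
        ≤⟨ p≤∣p∣ _ ⟩
      ℚ.∣ 1ℚ ℚ.+ seq x n ∣
        ≡⟨ cong ℚ.∣_∣ (regroup (seq x n) (seq (re z) n)) ⟩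
      ℚ.∣ (seq x n ℚ.- (seq (re z) n ℚ.- 1ℚ)) ℚ.+ seq (re z) n ∣
        ≤⟨ ℚ.∣p+q∣≤∣p∣+∣q∣ (seq x n ℚ.- (seq (re z) n ℚ.- 1ℚ)) (seq (re z) n) ⟩
      ℚ.∣ seq x n ℚ.- (seq (re z) n ℚ.- 1ℚ) ∣ ℚ.+ ℚ.∣ seq (re z) n ∣
        ≡⟨ cong (ℚ._+ ℚ.∣ seq (re z) n ∣) (≡.trans (∣-∣-swap (seq x n) (seq (re z) n ℚ.- 1ℚ))
             (cong (λ q → ℚ.∣ q ℚ.- seq x n ∣) (≡.sym (seq-re-minus-1 n)))) ⟩
      ℚ.∣ seq (re (z + - 1#)) n ℚ.- seq x n ∣ ℚ.+ ℚ.∣ seq (re z) n ∣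
        <⟨ ℚ.+-mono-< (h n N≤n) small ⟩
      1ℚ ∎)
    where
    open ℚ.≤-Reasoning

    seq-re-minus-1 : ∀ n → seq (re (z + - 1#)) n ≡ seq (re z) n ℚ.- 1ℚ
    seq-re-minus-1 n = ≡.trans (cong (λ x → seq x n) (re-+ z (- 1#)))
      (≡.trans (seq-+ (re z) (re (- 1#)) n)
        (cong (seq (re z) n ℚ.+_)
          (≡.trans (cong (λ x → seq x n) (re-neg 1#)) (seq-neg 1ℝ n))))

nonNeg-real : ∀ {z} → NonNegative z → conj z ≈ z
nonNeg-real (nonNeg x x≥0 z≈x) =
  trans (conj-cong z≈x) (trans (𝐑.refl ,ᶜ 𝐑.-0#≈0#) (sym z≈x))

conj-1 : conj 1# ≈ 1#
conj-1 = nonNeg-real nonNeg-1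

nonNeg-square : ∀ {z} → conj z ≈ z → NonNegative (z * z)
nonNeg-square {z} real = nonNeg-cong (𝐂.*-congˡ real) (nonNeg-*-conj z)

-- As z is real, r = r · conj (r z) = |r|² z.
nonNeg-inverse : ∀ {r z} → NonNegative z → r * z ≈ 1# → NonNegative r
nonNeg-inverse {r} {z} z≥0 rz≈1 = nonNeg-cong (begin
    r * conj r * z         ≈⟨ 𝐂.*-assoc r (conj r) z ⟩
    r * (conj r * z)       ≈⟨ 𝐂.*-congˡ (𝐂.*-congˡ (nonNeg-real z≥0)) ⟨
    r * (conj r * conj z)  ≈⟨ 𝐂.*-congˡ (trans (sym (conj-* r z)) (trans (conj-cong rz≈1) conj-1)) ⟩
    r * 1#                 ≈⟨ 𝐂.*-identityʳ r ⟩
    r                      ∎)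
  (nonNeg-* (nonNeg-*-conj r) z≥0)
  where open SetoidReasoning 𝐂.setoid

-- Sums and matrices

∑-cong : ∀ n {f g : Vector ℂ n} → (∀ i → f i ≈ g i) → ∑[ i < n ] f i ≈ ∑[ i < n ] g i
∑-cong n = sum-cong-≋

∑-+ : ∀ n {f g : Vector ℂ n} → ∑[ i < n ] (f i + g i) ≈ ∑[ i < n ] f i + ∑[ i < n ] g i
∑-+ n {f} {g} = ∑-distrib-+ f g

*-∑ : ∀ n x {f : Vector ℂ n} → x * ∑[ i < n ] f i ≈ ∑[ i < n ] (x * f i)
*-∑ n x {f} = *-distribˡ-sum x f

∑-* : ∀ n x {f : Vector ℂ n} → (∑[ i < n ] f i) * x ≈ ∑[ i < n ] (f i * x)
∑-* n x {f} = *-distribʳ-sum x f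

∑-*-∑ : ∀ m n (f : Vector ℂ m) (g : Vector ℂ n) →
  (∑[ i < m ] f i) * (∑[ j < n ] g j) ≈ ∑[ i < m ] ∑[ j < n ] (f i * g j)
∑-*-∑ m n f g = trans (∑-* m _) (∑-cong m λ i → *-∑ n (f i))

sum-zero : ∀ {n} {v : Vector ℂ n} → (∀ i → v i ≈ 0#) → sum v ≈ 0#
sum-zero {n} v≈0 = trans (sum-cong-≋ v≈0) (sum-replicate-zero n)

sum-single : ∀ {n} (i : Fin n) {v : Vector ℂ n} → (∀ j → j ≢ i → v j ≈ 0#) → sum v ≈ v i
sum-single zero v≈0 = trans (𝐂.+-congˡ (sum-zero (λ j → v≈0 (suc j) λ ()))) (𝐂.+-identityʳ _)
sum-single (suc i) v≈0 = trans
  (𝐂.+-cong (v≈0 zero λ ()) (sum-single i λ j j≢i → v≈0 (suc j) λ { ≡.refl → j≢i ≡.refl }))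
  (𝐂.+-identityˡ _)

conj-sum : ∀ {n} (v : Vector ℂ n) → conj (sum v) ≈ sum (conj ∘ v)
conj-sum {zero}  v = conj-0
conj-sum {suc n} v = trans (conj-+ _ _) (𝐂.+-congˡ (conj-sum (v ∘ suc)))

-- Translates the counting in `p-count` into a complex sum. The enumeration `g` is arbitrary so that
-- the induction can pass to `g ∘ suc`.
sum-indicator : ∀ {m} {A : Set} {P : A → Set} (P? : Decidable P) (g : Fin m → A) {v : Vector ℂ m} →
  (∀ i → P (g i) → v i ≈ 1#) → (∀ i → ¬ P (g i) → v i ≈ 0#) →
  sum v ≈ length (filter P? (tabulate g)) ×ⁿ 1#
sum-indicator {zero}  P? g v≈1 v≈0 = refl
sum-indicator {suc m} P? g v≈1 v≈0 with P? (g zero)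
... | yes p = 𝐂.+-cong (v≈1 zero p) (sum-indicator P? (g ∘ suc) (v≈1 ∘ suc) (v≈0 ∘ suc))
... | no ¬p = trans (𝐂.+-cong (v≈0 zero ¬p) (sum-indicator P? (g ∘ suc) (v≈1 ∘ suc) (v≈0 ∘ suc)))
  (𝐂.+-identityˡ _)

module _ {n : ℕ} where
  open SetoidReasoning 𝐂.setoid

  ⊡-· : ∀ (F G : Matrix n) v → (F ⊡ G) · v ≋ F · (G · v)
  ⊡-· F G v y = begin
    ∑[ z < n ] (∑[ w < n ] (F y w * G w z) * v z)    ≈⟨ ∑-cong n (λ z → ∑-* n (v z)) ⟩
    ∑[ z < n ] ∑[ w < n ] (F y w * G w z * v z)      ≈⟨ ∑-comm (λ z w → F y w * G w z * v z) ⟩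
    ∑[ w < n ] ∑[ z < n ] (F y w * G w z * v z)      ≈⟨ ∑-cong n (λ w → ∑-cong n (λ z → 𝐂.*-assoc _ _ _)) ⟩
    ∑[ w < n ] ∑[ z < n ] (F y w * (G w z * v z))    ≈⟨ ∑-cong n (λ w → *-∑ n (F y w)) ⟨
    ∑[ w < n ] (F y w * ∑[ z < n ] (G w z * v z))    ∎

  ⊡-cong : ∀ {F F′ G G′ : Matrix n} → F ≈ᴹ F′ → G ≈ᴹ G′ → F ⊡ G ≈ᴹ F′ ⊡ G′
  ⊡-cong p q y z = ∑-cong n λ w → 𝐂.*-cong (p y w) (q w z)

matrixRing : ℕ → RingWithoutOne 0ℓ 0ℓ
matrixRing n = record
  { Carrier = Matrix n ; _≈_ = _≈ᴹ_ ; _+_ = _⊞_ ; _*_ = _⊡_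
  ; -_ = λ F y z → - F y z ; 0# = 0ᴹ
  ; isRingWithoutOne = record
    { +-isAbelianGroup = Pointwise.isAbelianGroup (Fin n)
        (Pointwise.isAbelianGroup (Fin n) 𝐂.+-isAbelianGroup)
    ; *-cong = ⊡-cong
    ; *-assoc = λ F G H y z → ⊡-· F G (λ w → H w z) y
    ; distrib =
        (λ F G H y z → trans (∑-cong n λ w → 𝐂.distribˡ (F y w) (G w z) (H w z)) (∑-+ n)) ,
        (λ F G H y z → trans (∑-cong n λ w → 𝐂.distribʳ (F w z) (G y w) (H y w)) (∑-+ n))
    }
  }

-- Splitting an idempotent along a commuting one

module Idempotents {c ℓ} (R : RingWithoutOne c ℓ) where
  open RingWithoutOne R hiding (refl; sym; trans)
    renaming (_≈_ to _≈ᴿ_; _*_ to _∙_; _+_ to _+ᴿ_; 0# to 0ᴿ; -_ to -ᴿ_)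
  open RingWithoutOneProperties R
  open GroupProperties +-group using (ε⁻¹≈ε)
  open SetoidReasoning setoid
  private module ≈ᴿ = RingWithoutOne R

  -- e = ef + (e - ef) is a sum of two mutually orthogonal idempotents, the kind of decomposition
  -- that primitivity of e restricts.
  module Properties {e f : Carrier} (ee≈e : e ∙ e ≈ᴿ e) (ff≈f : f ∙ f ≈ᴿ f) (ef≈fe : e ∙ f ≈ᴿ f ∙ e) where
    absorbˡ : e ∙ (e ∙ f) ≈ᴿ e ∙ f
    absorbˡ = ≈ᴿ.trans (≈ᴿ.sym (*-assoc e e f)) (*-congʳ ee≈e)

    absorbʳ : (e ∙ f) ∙ e ≈ᴿ e ∙ f
    absorbʳ = ≈ᴿ.trans (*-assoc e f e) (≈ᴿ.trans (*-congˡ (≈ᴿ.sym ef≈fe)) absorbˡ)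

    product-idempotent : (e ∙ f) ∙ (e ∙ f) ≈ᴿ e ∙ f
    product-idempotent = begin
      (e ∙ f) ∙ (e ∙ f)  ≈⟨ *-assoc (e ∙ f) e f ⟨
      (e ∙ f) ∙ e ∙ f    ≈⟨ *-congʳ absorbʳ ⟩
      e ∙ f ∙ f          ≈⟨ *-assoc e f f ⟩
      e ∙ (f ∙ f)        ≈⟨ *-congˡ ff≈f ⟩
      e ∙ f              ∎

    complement = e +ᴿ -ᴿ (e ∙ f)

    product-complement : (e ∙ f) ∙ complement ≈ᴿ 0ᴿ
    product-complement = begin
      (e ∙ f) ∙ complement                      ≈⟨ x[y-z]≈xy-xz (e ∙ f) e (e ∙ f) ⟩
      (e ∙ f) ∙ e +ᴿ -ᴿ ((e ∙ f) ∙ (e ∙ f))     ≈⟨ +-cong absorbʳ (-‿cong product-idempotent) ⟩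
      e ∙ f +ᴿ -ᴿ (e ∙ f)                       ≈⟨ -‿inverseʳ (e ∙ f) ⟩
      0ᴿ                                        ∎

    complement-product : complement ∙ (e ∙ f) ≈ᴿ 0ᴿ
    complement-product = begin
      complement ∙ (e ∙ f)                      ≈⟨ [y-z]x≈yx-zx (e ∙ f) e (e ∙ f) ⟩
      e ∙ (e ∙ f) +ᴿ -ᴿ ((e ∙ f) ∙ (e ∙ f))     ≈⟨ +-cong absorbˡ (-‿cong product-idempotent) ⟩
      e ∙ f +ᴿ -ᴿ (e ∙ f)                       ≈⟨ -‿inverseʳ (e ∙ f) ⟩
      0ᴿ                                        ∎

    complement-idempotent : complement ∙ complement ≈ᴿ complement
    complement-idempotent = begin
      complement ∙ complement                              ≈⟨ x[y-z]≈xy-xz complement e (e ∙ f) ⟩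
      complement ∙ e +ᴿ -ᴿ (complement ∙ (e ∙ f))          ≈⟨ +-congˡ (-‿cong complement-product) ⟩
      complement ∙ e +ᴿ -ᴿ 0ᴿ                              ≈⟨ +-congˡ ε⁻¹≈ε ⟩
      complement ∙ e +ᴿ 0ᴿ                                 ≈⟨ +-identityʳ _ ⟩
      complement ∙ e                                       ≈⟨ [y-z]x≈yx-zx e e (e ∙ f) ⟩
      e ∙ e +ᴿ -ᴿ ((e ∙ f) ∙ e)                            ≈⟨ +-cong ee≈e (-‿cong absorbʳ) ⟩
      complement                                           ∎

    product+complement : e ≈ᴿ e ∙ f +ᴿ complement
    product+complement = ≈ᴿ.sym (≈ᴿ.trans (+-comm (e ∙ f) complement) (≈ᴿ.trans (+-assoc e _ _)
      (≈ᴿ.trans (+-congˡ (-‿inverseˡ (e ∙ f))) (+-identityʳ e))))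

-- The Bose–Mesner algebra

conjᴹ : ∀ {n} → Matrix n → Matrix n
conjᴹ F y z = conj (F y z)

conjᴹ-⊡ : ∀ {n} (F G : Matrix n) → conjᴹ (F ⊡ G) ≈ᴹ conjᴹ F ⊡ conjᴹ G
conjᴹ-⊡ {n} F G y z = trans (conj-sum (λ w → F y w * G w z)) (∑-cong n λ w → conj-* (F y w) (G w z))

module Scheme {n D : ℕ} (𝒳 : SymmetricAssociationScheme n D) where
  open SymmetricAssociationScheme 𝒳
  open SetoidReasoning 𝐂.setoid

  R-refl : ∀ y → R y y ≡ zero
  R-refl y = Equivalence.from (diagonal y y) ≡.refl

  R≡zero⇒≡ : ∀ {y z} → R y z ≡ zero → y ≡ z
  R≡zero⇒≡ = Equivalence.to (diagonal _ _)

  A-≡ : ∀ {i y z} → R y z ≡ i → A 𝒳 i y z ≈ 1#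
  A-≡ {i} {y} {z} eq with R y z Fin.≟ i
  ... | yes _ = refl
  ... | no ¬eq = contradiction eq ¬eq

  A-≢ : ∀ {i y z} → R y z ≢ i → A 𝒳 i y z ≈ 0#
  A-≢ {i} {y} {z} ¬eq with R y z Fin.≟ i
  ... | yes eq = contradiction eq ¬eq
  ... | no _ = refl

  ∑-A : ∀ (c : Vector ℂ (suc D)) y z → ∑[ i < suc D ] (c i * A 𝒳 i y z) ≈ c (R y z)
  ∑-A c y z = begin
    ∑[ i < suc D ] (c i * A 𝒳 i y z)
      ≈⟨ sum-single (R y z) (λ i i≢ → trans (𝐂.*-congˡ (A-≢ (i≢ ∘ ≡.sym))) (𝐂.zeroʳ (c i))) ⟩
    c (R y z) * A 𝒳 (R y z) y z  ≈⟨ 𝐂.*-congˡ (A-≡ ≡.refl) ⟩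
    c (R y z) * 1#               ≈⟨ 𝐂.*-identityʳ _ ⟩
    c (R y z)                    ∎

  -- Exactly one `A 𝒳 i` is nonzero at a given pair, so membership in the algebra means that entries
  -- depend only on the relation containing the pair.
  coefficient : ∀ {F} (b : BoseMesner 𝒳 F) y z → F y z ≈ proj₁ b (R y z)
  coefficient (c , eq) y z = trans (eq y z) (∑-A c y z)

  fromCoefficients : ∀ {F} (c : Vector ℂ (suc D)) → (∀ y z → F y z ≈ c (R y z)) → BoseMesner 𝒳 F
  fromCoefficients c eq = c , λ y z → trans (eq y z) (sym (∑-A c y z))

  BM-constant : ∀ {F} → BoseMesner 𝒳 F → ∀ {y z y′ z′} → R y z ≡ R y′ z′ → F y z ≈ F y′ z′
  BM-constant b {y} {z} {y′} {z′} eq = trans (coefficient b y z)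
    (trans (𝐂.reflexive (cong (proj₁ b) eq)) (sym (coefficient b y′ z′)))

  BM-symmetric : ∀ {F} → BoseMesner 𝒳 F → ∀ y z → F y z ≈ F z y
  BM-symmetric b y z = BM-constant b (symmetric y z)

  BM-conj : ∀ {F} → BoseMesner 𝒳 F → BoseMesner 𝒳 (conjᴹ F)
  BM-conj b = fromCoefficients (conj ∘ proj₁ b) λ y z → conj-cong (coefficient b y z)

  BM-minus : ∀ {F G} → BoseMesner 𝒳 F → BoseMesner 𝒳 G → BoseMesner 𝒳 (F ⊞ λ y z → - G y z)
  BM-minus b c = fromCoefficients (λ i → proj₁ b i + - proj₁ c i) λ y z →
    𝐂.+-cong (coefficient b y z) (𝐂.-‿cong (coefficient c y z))

  ∑-p : ∀ i j y z → ∑[ w < n ] (A 𝒳 i y w * A 𝒳 j w z) ≈ p i j (R y z) ×ⁿ 1#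
  ∑-p i j y z = trans
    (sum-indicator (λ w → R y w Fin.≟ i ×-dec R w z Fin.≟ j) id
      (λ w (eq , eq′) → trans (𝐂.*-cong (A-≡ eq) (A-≡ eq′)) (𝐂.*-identityˡ 1#))
      off)
    (𝐂.reflexive (cong (_×ⁿ 1#) (p-count i j y z)))
    where
    off : ∀ w → ¬ (R y w ≡ i × R w z ≡ j) → A 𝒳 i y w * A 𝒳 j w z ≈ 0#
    off w ¬both with R y w Fin.≟ i
    ... | no ¬eq = 𝐂.zeroˡ _
    ... | yes eq = trans (𝐂.*-congˡ (A-≢ λ eq′ → ¬both (eq , eq′))) (𝐂.zeroʳ 1#)

  -- A product of two associate matrices has the intersection numbers as its entries, and these
  -- depend only on the relation.
  BM-⊡ : ∀ {F G} → BoseMesner 𝒳 F → BoseMesner 𝒳 G → BoseMesner 𝒳 (F ⊡ G)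
  BM-⊡ {F} {G} (f , F≈) (g , G≈) = fromCoefficients
    (λ k → ∑[ i < suc D ] ∑[ j < suc D ] (f i * g j * (p i j k ×ⁿ 1#))) λ y z → begin
      ∑[ w < n ] (F y w * G w z)
        ≈⟨ ∑-cong n (λ w → expand y w z) ⟩
      ∑[ w < n ] ∑[ i < suc D ] ∑[ j < suc D ] (f i * g j * (A 𝒳 i y w * A 𝒳 j w z))
        ≈⟨ ∑-comm (λ w i → ∑[ j < suc D ] (f i * g j * (A 𝒳 i y w * A 𝒳 j w z))) ⟩
      ∑[ i < suc D ] ∑[ w < n ] ∑[ j < suc D ] (f i * g j * (A 𝒳 i y w * A 𝒳 j w z))
        ≈⟨ ∑-cong (suc D) (λ i → ∑-comm (λ w j → f i * g j * (A 𝒳 i y w * A 𝒳 j w z))) ⟩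
      ∑[ i < suc D ] ∑[ j < suc D ] ∑[ w < n ] (f i * g j * (A 𝒳 i y w * A 𝒳 j w z))
        ≈⟨ ∑-cong (suc D) (λ i → ∑-cong (suc D) λ j → trans
             (sym (*-∑ n (f i * g j)))
             (𝐂.*-congˡ (∑-p i j y z))) ⟩
      ∑[ i < suc D ] ∑[ j < suc D ] (f i * g j * (p i j (R y z) ×ⁿ 1#)) ∎
    where
    expand : ∀ y w z → F y w * G w z ≈
      ∑[ i < suc D ] ∑[ j < suc D ] (f i * g j * (A 𝒳 i y w * A 𝒳 j w z))
    expand y w z = begin
      F y w * G w z
        ≈⟨ 𝐂.*-cong (F≈ y w) (G≈ w z) ⟩
      ∑[ i < suc D ] (f i * A 𝒳 i y w) * ∑[ j < suc D ] (g j * A 𝒳 j w z)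
        ≈⟨ ∑-*-∑ (suc D) (suc D) (λ i → f i * A 𝒳 i y w) (λ j → g j * A 𝒳 j w z) ⟩
      ∑[ i < suc D ] ∑[ j < suc D ] (f i * A 𝒳 i y w * (g j * A 𝒳 j w z))
        ≈⟨ ∑-cong (suc D) (λ i → ∑-cong (suc D) λ j → solve 4
             (λ a b c d → a :* b :* (c :* d) := a :* c :* (b :* d)) refl
             (f i) (A 𝒳 i y w) (g j) (A 𝒳 j w z)) ⟩
      ∑[ i < suc D ] ∑[ j < suc D ] (f i * g j * (A 𝒳 i y w * A 𝒳 j w z)) ∎

  -- F G lies in the algebra and is therefore symmetric, while its transpose is G F because both
  -- factors are symmetric.
  BM-comm : ∀ {F G} → BoseMesner 𝒳 F → BoseMesner 𝒳 G → F ⊡ G ≈ᴹ G ⊡ F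
  BM-comm {F} {G} b c y z = begin
    (F ⊡ G) y z                 ≈⟨ BM-symmetric (BM-⊡ b c) y z ⟩
    ∑[ w < n ] (F z w * G w y)  ≈⟨ ∑-cong n (λ w → trans (𝐂.*-comm _ _)
                                     (𝐂.*-cong (BM-symmetric c w y) (BM-symmetric b z w))) ⟩
    (G ⊡ F) y z                 ∎

  -- Primitivity is applied to F = FG + (F - FG). As FG is nonzero, the other summand cannot be
  -- nonzero, and stability of equality makes each of its entries zero.
  absorbs : ∀ {F G} → IsPrimitiveIdempotent 𝒳 F → BoseMesner 𝒳 G → G ⊡ G ≈ᴹ G →
    ¬ (F ⊡ G ≈ᴹ 0ᴹ) → F ≈ᴹ F ⊡ G
  absorbs {F} {G} prim b GG≈G FG≉0 y z = 𝐂.x∙y⁻¹≈ε⇒x≈y _ _ (≈0-stable _ λ ≉0 →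
    indecomposable (F ⊡ G) complement (BM-⊡ member b) (BM-minus member (BM-⊡ member b))
      product-idempotent complement-idempotent product-complement complement-product
      product+complement (FG≉0 , λ complement≈0 → ≉0 (complement≈0 y z)))
    where
    open IsPrimitiveIdempotent prim
    open Idempotents (matrixRing n)
    open Properties idempotent GG≈G (BM-comm member b)

  module Primitive .{{_ : ℕ.NonZero n}} {E : Fin (suc D) → Matrix n}
    (prims : ArePrimitiveIdempotents 𝒳 E) where
    open ArePrimitiveIdempotents prims public
    module _ (i : Fin (suc D)) where
      open IsPrimitiveIdempotent (primitives i) public

    E-symmetric : ∀ i y z → E i y z ≈ E i z y
    E-symmetric i = BM-symmetric (member i)

    -- If the product were nonzero, each idempotent would absorb the other, and commutativity would
    -- make them equal.
    orthogonal : ∀ i j → i ≢ j → E i ⊡ E j ≈ᴹ 0ᴹ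
    orthogonal i j i≢j y z = ≈0-stable _ λ ≉0 →
      i≢j (distinct i j λ y′ z′ →
        trans (absorbs (primitives i) (member j) (idempotent j) (λ ≈0 → ≉0 (≈0 y z)) y′ z′)
        (trans (BM-comm (member i) (member j) y′ z′)
        (sym (absorbs (primitives j) (member i) (idempotent i)
          (λ ≈0 → ≉0 (trans (BM-comm (member i) (member j) y z) (≈0 y z))) y′ z′))))

    -- F F̄ has diagonal entries Σ |F(y,w)|², so it cannot vanish; by primitivity
    -- F = F F̄, and the right-hand side is real.
    E-real : ∀ i y z → conj (E i y z) ≈ E i y z
    E-real i y z = begin
      conj (F y z)                   ≈⟨ conj-cong (F≈FF̄ y z) ⟩
      conj ((F ⊡ conjᴹ F) y z)       ≈⟨ conjᴹ-⊡ F (conjᴹ F) y z ⟩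
      (conjᴹ F ⊡ conjᴹ (conjᴹ F)) y z ≈⟨ ⊡-cong {F = conjᴹ F} (λ _ _ → refl)
                                          (λ y z → conj-involutive (F y z)) y z ⟩
      (conjᴹ F ⊡ F) y z              ≈⟨ BM-comm (BM-conj (member i)) (member i) y z ⟩
      (F ⊡ conjᴹ F) y z              ≈⟨ F≈FF̄ y z ⟨
      F y z                          ∎
      where
      F = E i

      F≈FF̄ : F ≈ᴹ F ⊡ conjᴹ F
      F≈FF̄ = absorbs (primitives i) (BM-conj (member i))
        (λ y z → trans (sym (conjᴹ-⊡ F F y z)) (conj-cong (idempotent i y z)))
        λ FF̄≈0 → nonzero i λ y w → *-conj-zero (F y w) (nonNeg-sum-zero
          (λ w → F y w * conj (F y w)) (λ w → nonNeg-*-conj (F y w))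
          (trans (∑-cong n λ w → 𝐂.*-congˡ (conj-cong (E-symmetric i y w))) (FF̄≈0 y y)) w)

-- Frobenius norms of triple products

∑-swap-scaled : ∀ n (k : Matrix n) (h : Fin n → Matrix n) →
  ∑[ z < n ] ∑[ v < n ] ∑[ w < n ] (k v w * h z v w) ≈
  ∑[ v < n ] ∑[ w < n ] (k v w * ∑[ z < n ] h z v w)
∑-swap-scaled n k h = begin
  ∑[ z < n ] ∑[ v < n ] ∑[ w < n ] (k v w * h z v w)
    ≈⟨ ∑-comm (λ z v → ∑[ w < n ] (k v w * h z v w)) ⟩
  ∑[ v < n ] ∑[ z < n ] ∑[ w < n ] (k v w * h z v w)
    ≈⟨ ∑-cong n (λ v → ∑-comm (λ z w → k v w * h z v w)) ⟩
  ∑[ v < n ] ∑[ w < n ] ∑[ z < n ] (k v w * h z v w)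
    ≈⟨ ∑-cong n (λ v → ∑-cong n λ w → *-∑ n (k v w)) ⟨
  ∑[ v < n ] ∑[ w < n ] (k v w * ∑[ z < n ] h z v w) ∎
  where open SetoidReasoning 𝐂.setoid

-- The identity aᵀ a = a, which for a symmetric matrix is idempotency.
IsGram : ∀ {n} → Matrix n → Set
IsGram {n} a = ∀ v w → ∑[ y < n ] (a y v * a y w) ≈ a v w

-- The Frobenius norms of the matrices a Δₓ(c) b, summed over x, where Δₓ(c) is
-- the diagonal matrix formed from row x of c.
module TripleProduct {n} (a b c : Matrix n)
  (a-gram : IsGram a) (b-gram : IsGram b) (c-gram : IsGram c) (b-symmetric : ∀ v w → b v w ≈ b w v) where
  open SetoidReasoning 𝐂.setoid

  T : Fin n → Matrix n
  T x y z = ∑[ w < n ] (a y w * (c x w * b w z))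

  -- Each square is a double sum over v and w whose terms factor into parts depending on x, y and z
  -- separately. The Gram identities of b, a and c then remove the sums over z, y and x in turn.
  ∑-T² : ∑[ x < n ] ∑[ y < n ] ∑[ z < n ] (T x y z * T x y z) ≈
         ∑[ v < n ] ∑[ w < n ] (b v w * (a v w * c v w))
  ∑-T² = begin
    ∑[ x < n ] ∑[ y < n ] ∑[ z < n ] (T x y z * T x y z)
      ≈⟨ ∑-cong n (λ x → ∑-cong n λ y → ∑-cong n λ z → expand x y z) ⟩
    ∑[ x < n ] ∑[ y < n ] ∑[ z < n ] ∑[ v < n ] ∑[ w < n ] (cc x v w * aa y v w * bb z v w)
      ≈⟨ ∑-cong n (λ x → ∑-cong n λ y → trans (∑-swap-scaled n (λ v w → cc x v w * aa y v w) bb)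
           (∑-cong n λ v → ∑-cong n λ w → trans (𝐂.*-congˡ (sum-bb v w))
             (solve 3 (λ p q r → p :* q :* r := r :* p :* q) refl (cc x v w) (aa y v w) (b v w)))) ⟩
    ∑[ x < n ] ∑[ y < n ] ∑[ v < n ] ∑[ w < n ] (b v w * cc x v w * aa y v w)
      ≈⟨ ∑-cong n (λ x → trans (∑-swap-scaled n (λ v w → b v w * cc x v w) aa)
           (∑-cong n λ v → ∑-cong n λ w → trans (𝐂.*-congˡ (a-gram v w))
             (solve 3 (λ p q r → p :* q :* r := p :* r :* q) refl (b v w) (cc x v w) (a v w)))) ⟩
    ∑[ x < n ] ∑[ v < n ] ∑[ w < n ] (b v w * a v w * cc x v w)
      ≈⟨ trans (∑-swap-scaled n (λ v w → b v w * a v w) cc)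
           (∑-cong n λ v → ∑-cong n λ w → trans (𝐂.*-congˡ (c-gram v w)) (𝐂.*-assoc _ _ _)) ⟩
    ∑[ v < n ] ∑[ w < n ] (b v w * (a v w * c v w)) ∎
    where
    aa bb cc : Fin n → Matrix n
    aa y v w = a y v * a y w
    bb z v w = b v z * b w z
    cc x v w = c x v * c x w

    sum-bb : ∀ v w → ∑[ z < n ] bb z v w ≈ b v w
    sum-bb v w = trans (∑-cong n λ z → 𝐂.*-cong (b-symmetric v z) (b-symmetric w z)) (b-gram v w)

    expand : ∀ x y z → T x y z * T x y z ≈
      ∑[ v < n ] ∑[ w < n ] (cc x v w * aa y v w * bb z v w)
    expand x y z = trans (∑-*-∑ n n (λ v → a y v * (c x v * b v z)) (λ w → a y w * (c x w * b w z)))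
      (∑-cong n λ v → ∑-cong n λ w →
        solve 6 (λ a a′ b b′ c c′ → a :* (c :* b) :* (a′ :* (c′ :* b′)) := c :* c′ :* (a :* a′) :* (b :* b′))
          refl (a y v) (a y w) (b v z) (b w z) (c x v) (c x w))

  module _ (a-real : ∀ v w → conj (a v w) ≈ a v w) (b-real : ∀ v w → conj (b v w) ≈ b v w)
           (c-real : ∀ v w → conj (c v w) ≈ c v w) where

    T-real : ∀ x y z → conj (T x y z) ≈ T x y z
    T-real x y z = trans (conj-sum (λ w → a y w * (c x w * b w z))) (∑-cong n λ w →
      trans (conj-* (a y w) (c x w * b w z))
        (𝐂.*-cong (a-real y w) (trans (conj-* (c x w) (b w z)) (𝐂.*-cong (c-real x w) (b-real w z)))))

    -- The entries are real, so their squares are nonnegative and a vanishing total kills each of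
    -- them.
    T-zero : ∑[ v < n ] ∑[ w < n ] (b v w * (a v w * c v w)) ≈ 0# → ∀ x y z → T x y z ≈ 0#
    T-zero ≈0 x y z = *-conj-zero (T x y z) (trans (𝐂.*-congˡ (T-real x y z))
      (nonNeg-sum-zero (TT x y) (TT≥0 x y)
        (nonNeg-sum-zero (λ y → sum (TT x y)) (λ y → nonNeg-sum (TT x y) (TT≥0 x y))
          (nonNeg-sum-zero (λ x → ∑[ y < n ] sum (TT x y))
            (λ x → nonNeg-sum (λ y → sum (TT x y)) (λ y → nonNeg-sum (TT x y) (TT≥0 x y)))
            (trans ∑-T² ≈0) x) y) z))
      where
      TT : Fin n → Matrix n
      TT x y z = T x y z * T x y z

      TT≥0 : ∀ x y z → NonNegative (TT x y z)
      TT≥0 x y z = nonNeg-square (T-real x y z)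

-- Diagonal entries of the primitive idempotents

module Diagonal {n D : ℕ} .{{_ : ℕ.NonZero n}} (𝒳 : SymmetricAssociationScheme n D)
  {E : Fin (suc D) → Matrix n} (prims : ArePrimitiveIdempotents 𝒳 E) where
  open Scheme 𝒳
  open Primitive prims
  open SetoidReasoning 𝐂.setoid

  E-gram : ∀ i → IsGram (E i)
  E-gram i v w = trans (∑-cong n λ y → 𝐂.*-congʳ (E-symmetric i y v)) (idempotent i v w)

  -- Writing F = E i and q for its constant diagonal entry, the vectors F ŷ have
  -- inner products F(y,z), so |F(x,w)| ≤ q and q = Σ F(x,w)² ≤ n q².  As q ≠ 0, this
  -- gives the effective bound q ≥ 1/n.
  module _ (i : Fin (suc D)) (x : Fin n) where
    private
      F : Matrix n
      F = E i

      q P ν : ℂ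
      q = F x x
      P = q + q
      ν = ∑[ w < n ] 1#

      F-real = E-real i

      rows : ∀ v w → ∑[ u < n ] (F v u * F w u) ≈ F v w
      rows v w = trans (∑-cong n λ u → 𝐂.*-cong (E-symmetric i v u) (E-symmetric i w u)) (E-gram i v w)

      diagonal-constant : ∀ w → F w w ≈ q
      diagonal-constant w = BM-constant (member i) (≡.trans (R-refl w) (≡.sym (R-refl x)))

      q≥0 : NonNegative q
      q≥0 = nonNeg-cong (rows x x) (nonNeg-sum (λ u → F x u * F x u) λ u → nonNeg-square (F-real x u))

      q≉0 : q ≉ 0#
      q≉0 q≈0 = nonzero i λ y w → *-conj-zero (F y w) (trans (𝐂.*-congˡ (F-real y w))
        (nonNeg-sum-zero (λ u → F y u * F y u) (λ u → nonNeg-square (F-real y u))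
          (trans (rows y y) (trans (diagonal-constant y) q≈0)) w))

      P≥0 : NonNegative P
      P≥0 = nonNeg-+ q≥0 q≥0

      -- The expression is the squared norm of F x̂ + s F ŵ; s = 1 and s = -1 together express
      -- |F(x,w)| ≤ q.
      gram : ∀ s → conj s ≈ s → s * s ≈ 1# → ∀ w → NonNegative (P + s * (F x w + F x w))
      gram s s-real ss≈1 w = nonNeg-cong (begin
          ∑[ u < n ] ((F x u + s * F w u) * (F x u + s * F w u))
            ≈⟨ ∑-cong n (λ u → solve 3
                 (λ a b s → (a :+ s :* b) :* (a :+ s :* b) :=
                   a :* a :+ (s :* (a :* b) :+ (s :* (a :* b) :+ s :* s :* (b :* b))))
                 refl (F x u) (F w u) s) ⟩
          ∑[ u < n ] (F x u * F x u + (s * (F x u * F w u) + (s * (F x u * F w u) + s * s * (F w u * F w u))))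
            ≈⟨ trans (∑-+ n) (𝐂.+-congˡ (trans (∑-+ n) (𝐂.+-congˡ (∑-+ n)))) ⟩
          ∑[ u < n ] (F x u * F x u) + (∑[ u < n ] (s * (F x u * F w u)) +
            (∑[ u < n ] (s * (F x u * F w u)) + ∑[ u < n ] (s * s * (F w u * F w u))))
            ≈⟨ 𝐂.+-cong (rows x x) (𝐂.+-cong cross (𝐂.+-cong cross
                 (trans (sym (*-∑ n (s * s))) (trans
                   (𝐂.*-cong ss≈1 (trans (rows w w) (diagonal-constant w))) (𝐂.*-identityˡ q))))) ⟩
          q + (s * F x w + (s * F x w + q))
            ≈⟨ solve 3 (λ q s a → q :+ (s :* a :+ (s :* a :+ q)) := q :+ q :+ s :* (a :+ a)) refl q s (F x w) ⟩
          P + s * (F x w + F x w) ∎)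
        (nonNeg-sum (λ u → (F x u + s * F w u) * (F x u + s * F w u)) λ u → nonNeg-square
          (trans (conj-+ (F x u) (s * F w u)) (𝐂.+-cong (F-real x u)
            (trans (conj-* s (F w u)) (𝐂.*-cong s-real (F-real w u))))))
        where
        cross : ∑[ u < n ] (s * (F x u * F w u)) ≈ s * F x w
        cross = trans (sym (*-∑ n s)) (𝐂.*-congˡ (rows x w))

      -1-real : conj (- 1#) ≈ - 1#
      -1-real = trans (conj-neg 1#) (𝐂.-‿cong conj-1)

      -- Equal to 4 (q² - F(x,w)²), kept as a product of two squared norms so that nonnegativity is
      -- visible.
      gap : Fin n → ℂ
      gap w = (P + 1# * (F x w + F x w)) * (P + - 1# * (F x w + F x w))

      gap≥0 : ∀ w → NonNegative (gap w)
      gap≥0 w = nonNeg-* (gram 1# conj-1 (𝐂.*-identityˡ 1#) w)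
        (gram (- 1#) -1-real (trans (sym (𝐂.-‿distribˡ-* 1# (- 1#)))
          (trans (𝐂.-‿cong (𝐂.*-identityˡ (- 1#))) (𝐂.-‿involutive 1#))) w)

      gap+ : ∀ w → gap w + (F x w + F x w) * (F x w + F x w) ≈ P * P
      gap+ w = let m = F x w + F x w in begin
        (P + 1# * m) * (P + - 1# * m) + m * m
          ≈⟨ solve 3 (λ p m s → (p :+ con 1 :* m) :* (p :+ s :* m) :+ m :* m :=
               p :* p :+ (con 1 :+ s) :* (p :* m :+ m :* m)) refl P m (- 1#) ⟩
        P * P + (1# + - 1#) * (P * m + m * m)
          ≈⟨ 𝐂.+-congˡ (trans (𝐂.*-congʳ (𝐂.-‿inverseʳ 1#)) (𝐂.zeroˡ _)) ⟩
        P * P + 0#  ≈⟨ 𝐂.+-identityʳ _ ⟩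
        P * P       ∎

      ∑-gap : sum gap + (P + P) ≈ ν * (P * P)
      ∑-gap = begin
        sum gap + (P + P)
          ≈⟨ 𝐂.+-congˡ (trans
               (∑-cong n (λ w → solve 1 (λ a → (a :+ a) :* (a :+ a) := con 4 :* (a :* a)) refl (F x w)))
               (trans (sym (*-∑ n _)) (trans (𝐂.*-congˡ (rows x x))
                 (solve 1 (λ q → con 4 :* q := q :+ q :+ (q :+ q)) refl q)))) ⟨
        sum gap + ∑[ w < n ] ((F x w + F x w) * (F x w + F x w))
          ≈⟨ ∑-+ n ⟨
        ∑[ w < n ] (gap w + (F x w + F x w) * (F x w + F x w))
          ≈⟨ ∑-cong n (λ w → trans (gap+ w) (sym (𝐂.*-identityˡ (P * P)))) ⟩
        ∑[ w < n ] (1# * (P * P))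
          ≈⟨ ∑-* n (P * P) ⟨
        ν * (P * P) ∎

      -- Dividing `∑-gap` by P gives ν P = r · sum gap + 2, where both r and the gaps are
      -- nonnegative.
      νP≥1 : ∀ r → r * P ≈ 1# → NonNegative (ν * P + - 1#)
      νP≥1 r rP≈1 = nonNeg-cong (begin
          r * sum gap + 1#
            ≈⟨ 𝐂.+-identityʳ _ ⟨
          r * sum gap + 1# + 0#
            ≈⟨ 𝐂.+-congˡ (𝐂.-‿inverseʳ 1#) ⟨
          r * sum gap + 1# + (1# + - 1#)
            ≈⟨ solve 2 (λ t s → t :+ con 1 :+ (con 1 :+ s) := t :+ (con 1 :+ con 1) :+ s) refl _ _ ⟩
          r * sum gap + (1# + 1#) + - 1#
            ≈⟨ 𝐂.+-congʳ (𝐂.+-congˡ (𝐂.+-cong rP≈1 rP≈1)) ⟨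
          r * sum gap + (r * P + r * P) + - 1#
            ≈⟨ 𝐂.+-congʳ (solve 3 (λ r t p → r :* t :+ (r :* p :+ r :* p) := r :* (t :+ (p :+ p)))
                 refl r (sum gap) P) ⟩
          r * (sum gap + (P + P)) + - 1#
            ≈⟨ 𝐂.+-congʳ (𝐂.*-congˡ ∑-gap) ⟩
          r * (ν * (P * P)) + - 1#
            ≈⟨ 𝐂.+-congʳ (solve 3 (λ r ν p → r :* (ν :* (p :* p)) := r :* p :* (ν :* p)) refl r ν P) ⟩
          r * P * (ν * P) + - 1#
            ≈⟨ 𝐂.+-congʳ (trans (𝐂.*-congʳ rP≈1) (𝐂.*-identityˡ _)) ⟩
          ν * P + - 1# ∎)
        (nonNeg-+ (nonNeg-* (nonNeg-inverse P≥0 rP≈1) (nonNeg-sum gap gap≥0)) nonNeg-1)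

    diagonal-invertible : Invertible (E i x x)
    diagonal-invertible =
      -- The inverse of P is available only under a double negation, and `¬¬≥1⇒invertible` accepts a
      -- bound in that form. As P = 2q, the inverse of ν P yields one of q.
      let s , sνP≈1 = ¬¬≥1⇒invertible (ν * P) λ ¬νP≥1 →
            ≉0⇒¬¬invertible P (λ P≈0 → q≉0 (nonNeg-+-zero q≥0 q≥0 P≈0))
              λ (r , rP≈1) → ¬νP≥1 (νP≥1 r rP≈1)
      in s * ν + s * ν , trans
        (solve 3 (λ s ν q → (s :* ν :+ s :* ν) :* q := s :* (ν :* (q :+ q))) refl s ν q) sνP≈1

-- Entrywise polynomials

-- An inductive span in place of coefficient vectors: linear statements are proved by induction on
-- membership, and generators may be indexed by any type.
data Span {n} {I : Set} (g : I → Matrix n) : Matrix n → Set where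
  generator : ∀ i → Span g (g i)
  zero      : Span g 0ᴹ
  add       : ∀ {F G} → Span g F → Span g G → Span g (F ⊞ G)
  scale     : ∀ {F} c → Span g F → Span g (λ y z → c * F y z)
  resp      : ∀ {F G} → F ≈ᴹ G → Span g F → Span g G

module _ {n : ℕ} {I J : Set} {g : I → Matrix n} {h : J → Matrix n} where
  span-bind : (∀ i → Span h (g i)) → ∀ {F} → Span g F → Span h F
  span-bind k (generator i) = k i
  span-bind k zero          = zero
  span-bind k (add s t)     = add (span-bind k s) (span-bind k t)
  span-bind k (scale c s)   = scale c (span-bind k s)
  span-bind k (resp eq s)   = resp eq (span-bind k s)

  span-scale-entrywise : ∀ {H : Matrix n} → (∀ i → Span h (λ y z → H y z * g i y z)) →
    ∀ {F} → Span g F → Span h (λ y z → H y z * F y z)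
  span-scale-entrywise k (generator i) = k i
  span-scale-entrywise k zero = resp (λ y z → sym (𝐂.zeroʳ _)) zero
  span-scale-entrywise k (add s t) = resp (λ y z → sym (𝐂.distribˡ _ _ _))
    (add (span-scale-entrywise k s) (span-scale-entrywise k t))
  span-scale-entrywise {H} k (scale {F} c s) = resp
    (λ y z → solve 3 (λ c h f → c :* (h :* f) := h :* (c :* f)) refl c (H y z) (F y z))
    (scale c (span-scale-entrywise k s))
  span-scale-entrywise k (resp eq s) = resp (λ y z → 𝐂.*-congˡ (eq y z)) (span-scale-entrywise k s)

span-entrywise : ∀ {n I J K} {g : I → Matrix n} {h : J → Matrix n} {k : K → Matrix n} →
  (∀ i j → Span k (λ y z → g i y z * h j y z)) →
  ∀ {F G} → Span g F → Span h G → Span k (λ y z → F y z * G y z)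
span-entrywise gh s t = span-scale-entrywise
  (λ j → resp (λ y z → 𝐂.*-comm _ _)
    (span-scale-entrywise (λ i → resp (λ y z → 𝐂.*-comm _ _) (gh i j)) s)) t

span-sum : ∀ {n I} {g : I → Matrix n} {m} (F : Fin m → Matrix n) → (∀ i → Span g (F i)) →
  Span g (λ y z → ∑[ i < m ] F i y z)
span-sum {m = zero}  F s = zero
span-sum {m = suc m} F s = add (s zero) (span-sum (F ∘ suc) (s ∘ suc))

rootProduct : List ℂ → ℂ → ℂ
rootProduct []       t = 1#
rootProduct (a ∷ as) t = (t + - a) * rootProduct as t

rootProduct-cong : ∀ as {t u} → t ≈ u → rootProduct as t ≈ rootProduct as u
rootProduct-cong []       t≈u = refl
rootProduct-cong (a ∷ as) t≈u = 𝐂.*-cong (𝐂.+-congʳ t≈u) (rootProduct-cong as t≈u)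

rootProduct-zero : ∀ {as t} → Any (t ≈_) as → rootProduct as t ≈ 0#
rootProduct-zero (here t≈a) = trans (𝐂.*-congʳ (𝐂.x≈y⇒x∙y⁻¹≈ε t≈a)) (𝐂.zeroˡ _)
rootProduct-zero (there t∈) = trans (𝐂.*-congˡ (rootProduct-zero t∈)) (𝐂.zeroʳ _)

rootProduct-invertible : ∀ {as t} → All (λ a → Invertible (t + - a)) as → Invertible (rootProduct as t)
rootProduct-invertible [] = 1# , 𝐂.*-identityˡ 1#
rootProduct-invertible {a ∷ as} {t} ((r , rt≈1) ∷ inv) =
  let s , sp≈1 = rootProduct-invertible inv in
  r * s , trans
    (solve 4 (λ r s t p → r :* s :* (t :* p) := r :* t :* (s :* p)) refl r s (t + - a) (rootProduct as t))
    (trans (𝐂.*-cong rt≈1 sp≈1) (𝐂.*-identityˡ 1#))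

module Polynomials {n : ℕ} (G : Matrix n) where

  power : ℕ → Matrix n
  power l y z = G y z ^ l

  Below : ℕ → Set
  Below d = ∃ λ l → l < d

  -- The degree bound is strict: `Poly (suc d)` consists of entrywise polynomials in G of degree at
  -- most d. `Lower` below follows the same convention.
  Poly : ℕ → Matrix n → Set
  Poly d = Span {I = Below d} (power ∘ proj₁)

  power∈ : ∀ {l d} → l < d → Poly d (power l)
  power∈ {l} l<d = generator (l , l<d)

  Poly-mono : ∀ {d d′} → d ≤ d′ → ∀ {F} → Poly d F → Poly d′ F
  Poly-mono d≤d′ = span-bind λ (l , l<d) → power∈ (ℕ.<-≤-trans l<d d≤d′)

  Poly-G* : ∀ {d F} → Poly d F → Poly (suc d) (λ y z → G y z * F y z)
  Poly-G* = span-scale-entrywise λ (l , l<d) → power∈ (s≤s l<d)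

  Poly-* : ∀ {a b F H} → Poly (suc a) F → Poly (suc b) H → Poly (suc (a ℕ.+ b)) (λ y z → F y z * H y z)
  Poly-* = span-entrywise λ (l , l<a) (m , m<b) →
    resp (λ y z → ^-homo-* (G y z) l m) (power∈ (s≤s (ℕ.+-mono-≤ (ℕ.s≤s⁻¹ l<a) (ℕ.s≤s⁻¹ m<b))))

  hadamard∈ : ∀ {d F} → IsHadamardPolynomial d F G → Poly (suc d) F
  hadamard∈ {d} (c , _ , eq) = resp (λ y z → sym (eq y z))
    (span-sum (λ l y z → c l * G y z ^ toℕ l) λ l → scale (c l) (power∈ (Fin.toℕ<n l)))

  leading : ∀ {d F} → IsHadamardPolynomial d F G → ℂ
  leading {d} (c , _) = c (fromℕ d)

  leading-term : ∀ {d F} (h : IsHadamardPolynomial d F G) →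
    ∃[ H ] Poly d H × (∀ y z → F y z ≈ H y z + leading {d} {F} h * G y z ^ d)
  leading-term {d} (c , _ , eq) =
    (λ y z → ∑[ l < d ] (c (inject₁ l) * G y z ^ toℕ (inject₁ l))) ,
    span-sum (λ l y z → c (inject₁ l) * G y z ^ toℕ (inject₁ l))
      (λ l → scale (c (inject₁ l)) (power∈ (subst (_< d) (≡.sym (Fin.toℕ-inject₁ l)) (Fin.toℕ<n l)))) ,
    λ y z → trans (eq y z) (trans (sum-init-last (λ l → c l * G y z ^ toℕ l))
      (𝐂.+-congˡ (𝐂.*-congˡ (𝐂.reflexive (cong (G y z ^_) (Fin.toℕ-fromℕ d))))))

  rootProduct-monic : ∀ as → ∃[ H ] Poly (length as) H ×
    (∀ y z → rootProduct as (G y z) ≈ H y z + G y z ^ length as)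
  rootProduct-monic [] = 0ᴹ , zero , λ y z → sym (𝐂.+-identityˡ 1#)
  rootProduct-monic (a ∷ as) =
    let H , H∈ , eq = rootProduct-monic as
        l = length as
    in (λ y z → G y z * H y z + - a * (H y z + G y z ^ l)) ,
       add (Poly-G* H∈) (scale (- a) (add (Poly-mono (ℕ.n≤1+n l) H∈) (power∈ ℕ.≤-refl))) ,
       λ y z → trans (𝐂.*-congˡ (eq y z))
         (solve 4 (λ g a h p → (g :+ a) :* (h :+ p) := g :* h :+ a :* (h :+ p) :+ g :* p) refl
           (G y z) (- a) (H y z) (G y z ^ l))

  rootProduct∈ : ∀ as → Poly (suc (length as)) (λ y z → rootProduct as (G y z))
  rootProduct∈ as =
    let H , H∈ , eq = rootProduct-monic as in
    resp (λ y z → sym (eq y z)) (add (Poly-mono (ℕ.n≤1+n _) H∈) (power∈ ℕ.≤-refl))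

  module Graded {D} (E : Fin (suc D) → Matrix n)
    (polynomial : ∀ j → IsHadamardPolynomial (toℕ j) (E j) G) where

    lead : Fin (suc D) → ℂ
    lead j = leading {toℕ j} {E j} (polynomial j)

    Lower : ℕ → Matrix n → Set
    Lower d = Span {I = ∃ λ j → toℕ j < d} (E ∘ proj₁)

    E∈ : ∀ {j d} → toℕ j < d → Lower d (E j)
    E∈ {j} j<d = generator (j , j<d)

    Lower-mono : ∀ {d d′} → d ≤ d′ → ∀ {F} → Lower d F → Lower d′ F
    Lower-mono d≤d′ = span-bind λ (j , j<d) → E∈ (ℕ.<-≤-trans j<d d≤d′)

    module _ (lead-invertible : ∀ j → Invertible (lead j)) where

      -- The change of basis is triangular: E_l = H + c G^l entrywise, with H of degree below l and
      -- c invertible, so G^l = c⁻¹ (E_l - H), and induction handles H. The bound on d ensures that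
      -- E_l exists.
      poly⇒lower : ∀ d → d ≤ suc D → ∀ {F} → Poly d F → Lower d F
      poly⇒lower d d≤ = span-bind λ (l , l<d) → power∈lower d d≤ l l<d
        where
        power∈lower : ∀ d → d ≤ suc D → ∀ l → l < d → Lower d (power l)
        power∈lower (suc d) d<D l (s≤s l≤d) with ℕ.m≤n⇒m<n∨m≡n l≤d
        ... | inj₁ l<d = Lower-mono (ℕ.n≤1+n d) (power∈lower d (ℕ.<⇒≤ d<D) l l<d)
        ... | inj₂ ≡.refl = resp solved
          (add (scale r (E∈ (s≤s (ℕ.≤-reflexive j≡l))))
            (scale (- r) (Lower-mono (ℕ.n≤1+n l)
              (span-bind (λ (m , m<l) → power∈lower l (ℕ.<⇒≤ d<D) m m<l)
                (subst (λ d → Poly d H) j≡l H∈)))))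
          where
          j : Fin (suc D)
          j = fromℕ< d<D
          j≡l : toℕ j ≡ l
          j≡l = Fin.toℕ-fromℕ< d<D
          r : ℂ
          r = proj₁ (lead-invertible j)
          H : Matrix n
          H = proj₁ (leading-term {toℕ j} {E j} (polynomial j))
          H∈ : Poly (toℕ j) H
          H∈ = proj₁ (proj₂ (leading-term {toℕ j} {E j} (polynomial j)))
          solved : ∀ y z → r * E j y z + - r * H y z ≈ power l y z
          solved y z = begin
            r * E j y z + - r * H y z
              ≈⟨ 𝐂.+-congʳ (𝐂.*-congˡ (proj₂ (proj₂ (leading-term {toℕ j} {E j} (polynomial j))) y z)) ⟩
            r * (H y z + lead j * G y z ^ toℕ j) + - r * H y z
              ≈⟨ solve 5 (λ r s h c p → r :* (h :+ c :* p) :+ s :* h := (r :+ s) :* h :+ r :* c :* p) refl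
                   r (- r) (H y z) (lead j) (G y z ^ toℕ j) ⟩
            (r + - r) * H y z + r * lead j * G y z ^ toℕ j
              ≈⟨ 𝐂.+-cong (trans (𝐂.*-congʳ (𝐂.-‿inverseʳ r)) (𝐂.zeroˡ _))
                   (trans (𝐂.*-congʳ (proj₂ (lead-invertible j))) (𝐂.*-identityˡ _)) ⟩
            0# + G y z ^ toℕ j
              ≈⟨ 𝐂.+-identityˡ _ ⟩
            G y z ^ toℕ j
              ≡⟨ cong (G y z ^_) j≡l ⟩
            G y z ^ l ∎
            where open SetoidReasoning 𝐂.setoid

-- Linear functionals and proportionality on spans

record IsLinear {n} (L : Matrix n → ℂ) : Set where
  field
    L-cong  : ∀ {F G} → F ≈ᴹ G → L F ≈ L G
    L-add   : ∀ F G → L (F ⊞ G) ≈ L F + L G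
    L-scale : ∀ c F → L (λ y z → c * F y z) ≈ c * L F

  L-zero : L 0ᴹ ≈ 0#
  L-zero = trans (L-cong λ y z → sym (𝐂.zeroˡ 0#)) (trans (L-scale 0# 0ᴹ) (𝐂.zeroˡ _))

module _ {n : ℕ} where
  open IsLinear

  entry-linear : ∀ y z → IsLinear {n} (λ F → F y z)
  entry-linear y z = record
    { L-cong = λ eq → eq y z ; L-add = λ _ _ → refl ; L-scale = λ _ _ → refl }

  *ˡ-linear : ∀ a {L : Matrix n → ℂ} → IsLinear L → IsLinear (λ F → a * L F)
  *ˡ-linear a {L} lin = record
    { L-cong = λ eq → 𝐂.*-congˡ (L-cong lin eq)
    ; L-add = λ F G → trans (𝐂.*-congˡ (L-add lin F G)) (𝐂.distribˡ a _ _)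
    ; L-scale = λ c F → trans (𝐂.*-congˡ (L-scale lin c F))
        (solve 3 (λ a c l → a :* (c :* l) := c :* (a :* l)) refl a c (L F))
    }

  *ʳ-linear : ∀ b {L : Matrix n → ℂ} → IsLinear L → IsLinear (λ F → L F * b)
  *ʳ-linear b lin = record
    { L-cong = λ eq → 𝐂.*-congʳ (L-cong lin eq)
    ; L-add = λ F G → trans (𝐂.*-congʳ (L-add lin F G)) (𝐂.distribʳ b _ _)
    ; L-scale = λ c F → trans (𝐂.*-congʳ (L-scale lin c F)) (𝐂.*-assoc c _ b)
    }

  ∑-linear : ∀ m {L : Fin m → Matrix n → ℂ} → (∀ i → IsLinear (L i)) → IsLinear (λ F → ∑[ i < m ] L i F)
  ∑-linear m {L} lin = record
    { L-cong = λ eq → ∑-cong m λ i → L-cong (lin i) eq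
    ; L-add = λ F G → trans (∑-cong m λ i → L-add (lin i) F G) (∑-+ m)
    ; L-scale = λ c F → trans (∑-cong m λ i → L-scale (lin i) c F) (sym (*-∑ m c))
    }

Proportional : ∀ {n} → Vector ℂ n → Vector ℂ n → Set
Proportional u v = ∃[ c ] u ≋ c ⊙ v

proportional-cong : ∀ {n} {u u′ v : Vector ℂ n} → u ≋ u′ → Proportional u v → Proportional u′ v
proportional-cong u≋u′ (c , eq) = c , λ y → trans (sym (u≋u′ y)) (eq y)

proportional-zero : ∀ {n} {u v : Vector ℂ n} → u ≋ 0ⱽ → Proportional u v
proportional-zero u≋0 = 0# , λ y → trans (u≋0 y) (sym (𝐂.zeroˡ _))

proportional-⊕ : ∀ {n} {u u′ v : Vector ℂ n} → Proportional u v → Proportional u′ v → Proportional (u ⊕ u′) v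
proportional-⊕ (c , eq) (c′ , eq′) = c + c′ , λ y → trans (𝐂.+-cong (eq y) (eq′ y)) (sym (𝐂.distribʳ _ c c′))

proportional-⊙ : ∀ {n} a {u v : Vector ℂ n} → Proportional u v → Proportional (a ⊙ u) v
proportional-⊙ a (c , eq) = a * c , λ y → trans (𝐂.*-congˡ (eq y)) (sym (𝐂.*-assoc a c _))

module _ {n : ℕ} {I : Set} {g : I → Matrix n} where
  open IsLinear

  -- A linear map that sends every generator into the line through v sends the whole span there.
  span-proportional : ∀ {m} (Φ : Matrix n → Vector ℂ m) → (∀ y → IsLinear (λ F → Φ F y)) →
    ∀ {v} → (∀ i → Proportional (Φ (g i)) v) → ∀ {F} → Span g F → Proportional (Φ F) v
  span-proportional Φ lin k (generator i) = k i
  span-proportional Φ lin k zero = proportional-zero λ y → L-zero (lin y)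
  span-proportional Φ lin k (add {F} {G} s t) = proportional-cong (λ y → sym (L-add (lin y) F G))
    (proportional-⊕ (span-proportional Φ lin k s) (span-proportional Φ lin k t))
  span-proportional Φ lin k (scale {F} c s) = proportional-cong (λ y → sym (L-scale (lin y) c F))
    (proportional-⊙ c (span-proportional Φ lin k s))
  span-proportional Φ lin k (resp eq s) = proportional-cong (λ y → L-cong (lin y) eq)
    (span-proportional Φ lin k s)

  span-vanishing : ∀ {L : Matrix n → ℂ} → IsLinear L → (∀ i → L (g i) ≈ 0#) → ∀ {F} → Span g F → L F ≈ 0#
  span-vanishing {L} lin k s =
    -- The functional is viewed as a map to one-dimensional vectors, with the zero vector in the
    -- role of v.
    let c , eq = span-proportional {1} (λ F _ → L F) (λ _ → lin) {0ⱽ}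
                   (λ i → proportional-zero λ _ → k i) s
    in trans (eq zero) (𝐂.zeroʳ c)

-- Action on vectors, and listing of finite subsets

basis-≡ : ∀ {n} {x y : Fin n} → x ≡ y → basis x y ≈ 1#
basis-≡ {x = x} {y} x≡y with x Fin.≟ y
... | yes _  = refl
... | no x≢y = contradiction x≡y x≢y

basis-≢ : ∀ {n} {x y : Fin n} → x ≢ y → basis x y ≈ 0#
basis-≢ {x = x} {y} x≢y with x Fin.≟ y
... | yes x≡y = contradiction x≡y x≢y
... | no _    = refl

·-basis : ∀ {n} (F : Matrix n) x y → (F · basis x) y ≈ F y x
·-basis F x y = trans
  (sum-single x {λ w → F y w * basis x w} λ w w≢x → trans (𝐂.*-congˡ (basis-≢ (w≢x ∘ ≡.sym))) (𝐂.zeroʳ _))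
  (trans (𝐂.*-congˡ (basis-≡ ≡.refl)) (𝐂.*-identityʳ _))

·-⊕ : ∀ {n} (F : Matrix n) u v → F · (u ⊕ v) ≋ (F · u) ⊕ (F · v)
·-⊕ {n} F u v y = trans (∑-cong n λ w → 𝐂.distribˡ (F y w) (u w) (v w)) (∑-+ n)

·-⊙ : ∀ {n} (F : Matrix n) a v → F · (a ⊙ v) ≋ a ⊙ (F · v)
·-⊙ {n} F a v y = trans
  (∑-cong n λ w → solve 3 (λ f a v → f :* (a :* v) := a :* (f :* v)) refl (F y w) a (v w)) (sym (*-∑ n a))

·-zero : ∀ {n} (F : Matrix n) {v} → v ≋ 0ⱽ → F · v ≋ 0ⱽ
·-zero F v≋0 y = sum-zero λ w → trans (𝐂.*-congˡ (v≋0 w)) (𝐂.zeroʳ _)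

x∉p-x : ∀ {m} (x : Fin m) (p : Subset m) → x ∉ˢ (p - x)
x∉p-x zero    (s ∷ p) ()
x∉p-x (suc x) (s ∷ p) (Vec.there x∈) = x∉p-x x p x∈

-- Supplies the roots of a polynomial whose degree is the cardinality of the subset.
enumerate : ∀ {m} (p : Subset m) →
  ∃[ l ] length l ≡ ∣ p ∣ × All (_∈ˢ p) l × (∀ {i} → i ∈ˢ p → i ∈ l)
enumerate [] = [] , ≡.refl , [] , λ ()
enumerate (s ∷ p) with enumerate p
enumerate (outside ∷ p) | l , len , l⊆p , p⊆l =
  map suc l , ≡.trans (List.length-map suc l) len , All.map⁺ (All.map Vec.there l⊆p) ,
  λ { (Vec.there i∈p) → ∈-map⁺ suc (p⊆l i∈p) }
enumerate (inside ∷ p) | l , len , l⊆p , p⊆l =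
  zero ∷ map suc l , cong suc (≡.trans (List.length-map suc l) len) ,
  Vec.here ∷ All.map⁺ (All.map Vec.there l⊆p) ,
  λ { Vec.here → here ≡.refl ; (Vec.there i∈p) → there (∈-map⁺ suc (p⊆l i∈p)) }

-- Cometric schemes

module Cometric {n D : ℕ} .{{_ : NonZero n}} (𝒳 : SymmetricAssociationScheme n D)
  {E : Fin (suc D) → Matrix n} (prims : ArePrimitiveIdempotents 𝒳 E) (e : Fin (suc D))
  (polynomial : ∀ j → IsHadamardPolynomial (toℕ j) (E j) (E e)) where
  open SymmetricAssociationScheme 𝒳
  open Scheme 𝒳
  open Primitive prims
  open Diagonal 𝒳 prims
  open Polynomials (E e)
  open Graded E polynomial
  open SetoidReasoning 𝐂.setoid

  G : Matrix n
  G = E e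

  θ : Vector ℂ (suc D)
  θ = proj₁ (member e)

  G≈θ : ∀ y z → G y z ≈ θ (R y z)
  G≈θ = coefficient (member e)

  lower-orthogonal : ∀ {j d F} → Lower d F → d ≤ toℕ j → E j ⊡ F ≈ᴹ 0ᴹ
  lower-orthogonal {j} F∈ d≤j y z = span-vanishing
    (∑-linear n λ w → *ˡ-linear (E j y w) (entry-linear w z))
    (λ (m , m<d) → orthogonal j m (λ { ≡.refl → ℕ.<⇒≱ m<d d≤j }) y z) F∈

  -- The sum is the trace of E_j Fᵀ; for F = E_m it is the trace of E_j E_m = 0.
  lower-trace : ∀ {j d F} → Lower d F → d ≤ toℕ j → ∑[ v < n ] ∑[ w < n ] (E j v w * F v w) ≈ 0#
  lower-trace {j} F∈ d≤j = span-vanishing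
    (∑-linear n λ v → ∑-linear n λ w → *ˡ-linear (E j v w) (entry-linear v w))
    (λ (m , m<d) → sum-zero λ v → trans (∑-cong n λ w → 𝐂.*-congˡ (E-symmetric m v w))
      (orthogonal j m (λ { ≡.refl → ℕ.<⇒≱ m<d d≤j }) v v)) F∈

  -- The product Δ(F) H, with Δ(F) the diagonal matrix formed from row x of F.
  row : Fin n → Matrix n → Matrix n → Matrix n
  row x F H w z = F x w * H w z

  module _ (lead-invertible : ∀ j → Invertible (lead j)) where

    -- A matrix form of the vanishing of the Krein parameters with m > j + l: the entrywise product
    -- of E_j and E_l lies in the span of E_0, ..., E_{j+l}, so its trace pairing with E_m is zero,
    -- and `T-zero` applies.
    E-row-E : ∀ {j l m} → toℕ j ℕ.+ toℕ l < toℕ m → ∀ x → E j ⊡ row x (E l) (E m) ≈ᴹ 0ᴹ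
    E-row-E {j} {l} {m} j+l<m x = T-zero (E-real j) (E-real m) (E-real l)
      (lower-trace (poly⇒lower lead-invertible (suc (toℕ j ℕ.+ toℕ l))
        (ℕ.≤-trans j+l<m (ℕ.<⇒≤ (Fin.toℕ<n m)))
        (Poly-* (hadamard∈ (polynomial j)) (hadamard∈ (polynomial l)))) j+l<m) x
      where open TripleProduct (E j) (E m) (E l) (E-gram j) (E-gram m) (E-gram l) (E-symmetric m)

    E-row-lower-E : ∀ {j d m F} → Lower d F → toℕ j ℕ.+ d ≤ toℕ m → ∀ x → E j ⊡ row x F (E m) ≈ᴹ 0ᴹ
    E-row-lower-E {j} {d} {m} F∈ j+d≤m x y z = span-vanishing
      (∑-linear n λ w → *ˡ-linear (E j y w) (*ʳ-linear (E m w z) (entry-linear x w)))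
      (λ (l , l<d) → E-row-E {j} {l} {m} (ℕ.<-≤-trans (ℕ.+-monoʳ-< (toℕ j) l<d) j+d≤m) x y z) F∈

    -- By symmetry, row x of E_m is the vector E_m x̂, and E_j E_m x̂ is either E_j x̂ or zero.
    E-lower-column : ∀ {j d F} → Lower d F → ∀ x → Proportional (E j · (λ w → F x w)) (E j · basis x)
    E-lower-column {j} F∈ x = span-proportional (λ F → E j · (λ w → F x w))
      (λ y → ∑-linear n λ w → *ˡ-linear (E j y w) (entry-linear x w))
      (λ (m , _) → proportional-cong
        (λ y → ∑-cong n λ w → 𝐂.*-congˡ (E-symmetric m w x)) (column m)) F∈
      where
      column : ∀ m → Proportional (λ y → (E j ⊡ E m) y x) (E j · basis x)
      column m with j Fin.≟ m
      ... | yes ≡.refl = 1# , λ y → trans (idempotent j y x)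
              (trans (sym (·-basis (E j) x y)) (sym (𝐂.*-identityˡ _)))
      ... | no j≢m = proportional-zero λ y → orthogonal j m j≢m y x

    top : Fin (suc D)
    top = fromℕ D

    -- If θ a ≈ θ b then E₁ satisfies an entrywise polynomial relation of degree D,
    -- so E_D lies in the span of E₀, …, E_{D-1}, to which it is orthogonal.
    θ-distinct : ∀ a b → a ≢ b → θ a ≉ θ b
    θ-distinct a b a≢b θa≈θb = nonzero top λ y z →
      trans (sym (idempotent top y z))
        (lower-orthogonal top∈ (ℕ.≤-reflexive (≡.sym (Fin.toℕ-fromℕ D))) y z)
      where
      -- These are the D values of θ at indices other than b; the value at b is covered by that at
      -- a.
      roots : List ℂ
      roots = tabulate (θ ∘ punchIn b)

      roots-length : length roots ≡ D
      roots-length = List.length-tabulate (θ ∘ punchIn b)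

      root : ∀ r → Any (θ r ≈_) roots
      root r with b Fin.≟ r
      ... | no b≢r = Any.tabulate⁺ (punchOut b≢r) (𝐂.reflexive (cong θ (≡.sym (Fin.punchIn-punchOut b≢r))))
      ... | yes ≡.refl = Any.tabulate⁺ (punchOut (a≢b ∘ ≡.sym)) (trans (sym θa≈θb)
              (𝐂.reflexive (cong θ (≡.sym (Fin.punchIn-punchOut (a≢b ∘ ≡.sym))))))

      H : Matrix n
      H = proj₁ (rootProduct-monic roots)

      H∈ : Poly D H
      H∈ = subst (λ d → Poly d H) roots-length (proj₁ (proj₂ (rootProduct-monic roots)))

      H+G^D≈0 : ∀ y z → H y z + G y z ^ D ≈ 0#
      H+G^D≈0 y z = trans (𝐂.+-congˡ (𝐂.reflexive (cong (G y z ^_) (≡.sym roots-length))))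
        (trans (sym (proj₂ (proj₂ (rootProduct-monic roots)) y z))
        (trans (rootProduct-cong roots (G≈θ y z)) (rootProduct-zero (root (R y z)))))

      G^D∈ : Poly D (power D)
      G^D∈ = resp (λ y z → begin
          - 1# * H y z                          ≈⟨ 𝐂.+-identityʳ _ ⟨
          - 1# * H y z + 0#                     ≈⟨ 𝐂.+-congˡ (H+G^D≈0 y z) ⟨
          - 1# * H y z + (H y z + G y z ^ D)
            ≈⟨ solve 3 (λ s h p → s :* h :+ (h :+ p) := (con 1 :+ s) :* h :+ p) refl (- 1#) (H y z) (G y z ^ D) ⟩
          (1# + - 1#) * H y z + G y z ^ D
            ≈⟨ 𝐂.+-congʳ (trans (𝐂.*-congʳ (𝐂.-‿inverseʳ 1#)) (𝐂.zeroˡ _)) ⟩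
          0# + G y z ^ D                        ≈⟨ 𝐂.+-identityˡ _ ⟩
          G y z ^ D                             ∎)
        (scale (- 1#) H∈)

      top∈ : Lower D (E top)
      top∈ = poly⇒lower lead-invertible D (ℕ.n≤1+n D) (span-bind low (hadamard∈ (polynomial top)))
        where
        low : ∀ (l : Below (suc (toℕ top))) → Poly D (power (proj₁ l))
        low (l , l<) with ℕ.m≤n⇒m<n∨m≡n (ℕ.≤-trans (ℕ.s≤s⁻¹ l<) (ℕ.≤-reflexive (Fin.toℕ-fromℕ D)))
        ... | inj₁ l<D    = power∈ l<D
        ... | inj₂ ≡.refl = G^D∈

    module _ (θ-invertible : ∀ a b → a ≢ b → Invertible (θ a + - θ b)) where

      -- f(G) taken entrywise, for the polynomial f with roots θ i, i in l. It vanishes on the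
      -- relations listed in l and is invertible on all others.
      nodes : List (Fin (suc D)) → Matrix n
      nodes l y z = rootProduct (map θ l) (G y z)

      nodes∈ : ∀ l → length l ≤ D → Lower (suc (length l)) (nodes l)
      nodes∈ l l≤D = subst (λ d → Lower (suc d) (nodes l)) (List.length-map θ l)
        (poly⇒lower lead-invertible _ (s≤s (ℕ.≤-trans (ℕ.≤-reflexive (List.length-map θ l)) l≤D))
          (rootProduct∈ (map θ l)))

      nodes-zero : ∀ {l y z} → R y z ∈ l → nodes l y z ≈ 0#
      nodes-zero {l} {y} {z} r∈l = trans (rootProduct-cong (map θ l) (G≈θ y z))
        (rootProduct-zero (Any.map⁺ (Any.map (λ eq → 𝐂.reflexive (cong θ eq)) r∈l)))

      nodes-invertible : ∀ {l k} → All (k ≢_) l → Invertible (rootProduct (map θ l) (θ k))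
      nodes-invertible {l} {k} k∉l = rootProduct-invertible (All.map⁺ (All.map (θ-invertible k _) k∉l))

      nodes-at : ∀ l {k y z} → R y z ≡ k → nodes l y z ≈ rootProduct (map θ l) (θ k)
      nodes-at l {k} {y} {z} eq = rootProduct-cong (map θ l)
        (trans (G≈θ y z) (𝐂.reflexive (cong θ eq)))

      -- Interpolation: the polynomial with roots θ 1, ..., θ D, divided by its value at θ 0, gives
      -- the identity matrix. This supplies the expansion of χ in the spaces E_m V.
      identity∈ : Lower (suc D) (A 𝒳 zero)
      identity∈ = resp eq (scale r (subst (λ d → Lower (suc d) (nodes l)) (List.length-tabulate suc)
        (nodes∈ l (ℕ.≤-reflexive (List.length-tabulate suc)))))
        where
        l : List (Fin (suc D))
        l = tabulate suc

        κ⁻¹ : Invertible (rootProduct (map θ l) (θ zero))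
        κ⁻¹ = nodes-invertible {l} {zero} (All.tabulate⁺ λ i ())

        r : ℂ
        r = proj₁ κ⁻¹

        at : ∀ {y z} k → R y z ≡ k → r * nodes l y z ≈ A 𝒳 zero y z
        at zero eq = trans (trans (𝐂.*-congˡ (nodes-at l eq)) (proj₂ κ⁻¹)) (sym (A-≡ eq))
        at (suc i) eq = trans
          (trans (𝐂.*-congˡ (nodes-zero (subst (_∈ l) (≡.sym eq) (Any.tabulate⁺ i ≡.refl)))) (𝐂.zeroʳ r))
          (sym (A-≢ λ eq′ → Fin.0≢1+n (≡.trans (≡.sym eq′) eq)))

        eq : ∀ y z → r * nodes l y z ≈ A 𝒳 zero y z
        eq y z = at (R y z) ≡.refl

      module _ (x : Fin n) (χ : Vector ℂ n) {δ : ℕ}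
        (low-vanish : ∀ m → m ≢ zero → toℕ m < δ → E m · χ ≋ 0ⱽ) where

        identity-· : A 𝒳 zero · χ ≋ χ
        identity-· y = trans
          (sum-single y {λ w → A 𝒳 zero y w * χ w} λ w w≢y →
            trans (𝐂.*-congʳ (A-≢ λ eq → w≢y (≡.sym (R≡zero⇒≡ eq)))) (𝐂.zeroˡ _))
          (trans (𝐂.*-congʳ (A-≡ (R-refl y))) (𝐂.*-identityˡ _))

        -- With χ written as I χ and I in the span of the E_m, linearity reduces the claim to each
        -- E_m χ separately.
        diagonal-χ : ∀ {j d F} → Lower d F → toℕ j ℕ.+ d ≤ δ →
          Proportional (E j · (λ w → F x w * χ w)) (E j · basis x)
        diagonal-χ {j} {d} {F} F∈ j+d≤δ = proportional-cong
          (λ y → ∑-cong n λ w → 𝐂.*-congˡ (𝐂.*-congˡ (identity-· w)))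
          (span-proportional (λ H → E j · (λ w → F x w * (H · χ) w))
            (λ y → ∑-linear n λ w → *ˡ-linear (E j y w) (*ˡ-linear (F x w)
              (∑-linear n λ z → *ʳ-linear (χ z) (entry-linear w z))))
            (λ (m , _) → part m) identity∈)
          where
          part : ∀ m → Proportional (E j · (λ w → F x w * (E m · χ) w)) (E j · basis x)
          -- E_0 χ is a constant vector, so only row x of F remains, up to a scalar, and
          -- `E-lower-column` applies.
          part zero = proportional-cong
            (λ y → sym (trans (∑-cong n λ w → trans
                (𝐂.*-congˡ (𝐂.*-congˡ (∑-cong n λ z → 𝐂.*-congʳ (trans (E₀ w z) (sym (E₀ x z))))))
                (solve 3 (λ a f c → a :* (f :* c) := c :* (a :* f)) refl (E j y w) (F x w) ((E zero · χ) x)))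
              (sym (*-∑ n ((E zero · χ) x)))))
            (proportional-⊙ ((E zero · χ) x) (E-lower-column {j} F∈ x))
          part m@(suc _) with toℕ m ℕ.<? δ
          ... | yes m<δ = proportional-zero (·-zero (E j) λ w →
                  trans (𝐂.*-congˡ (low-vanish m (λ ()) m<δ w)) (𝐂.zeroʳ (F x w)))
          -- Here m ≥ δ ≥ j + d, so E_j Δ(F) E_m = 0.
          ... | no m≮δ = proportional-zero λ y → begin
            ∑[ w < n ] (E j y w * (F x w * (E m · χ) w))
              ≈⟨ ∑-cong n (λ w → 𝐂.*-congˡ (trans (*-∑ n (F x w))
                   (∑-cong n λ z → sym (𝐂.*-assoc (F x w) (E m w z) (χ z))))) ⟩
            (E j · (row x F (E m) · χ)) y
              ≈⟨ ⊡-· (E j) (row x F (E m)) χ y ⟨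
            ((E j ⊡ row x F (E m)) · χ) y
              ≈⟨ sum-zero (λ z → trans (𝐂.*-congʳ
                   (E-row-lower-E {j} {m = m} F∈ (ℕ.≤-trans j+d≤δ (ℕ.≮⇒≥ m≮δ)) x y z)) (𝐂.zeroˡ _)) ⟩
            0# ∎

        module _ (S : Subset (suc D)) (δ≤D : δ ≤ D)
          (support : ∀ i → i ≢ zero → i ∉ˢ S → ∀ y → R x y ≡ i → χ y ≈ 0#) where

          shell : Fin (suc D) → Vector ℂ n
          shell k y = A 𝒳 k x y * χ y

          shell-zero : ∀ j → Proportional (E j · shell zero) (E j · basis x)
          shell-zero j = χ x , λ y → trans
            (∑-cong n λ w → 𝐂.*-congˡ (at-zero w)) (·-⊙ (E j) (χ x) (basis x) y)
            where
            at-zero : ∀ w → A 𝒳 zero x w * χ w ≈ χ x * basis x w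
            at-zero w with x Fin.≟ w
            ... | yes ≡.refl = trans (𝐂.*-comm _ _) (𝐂.*-congˡ (A-≡ (R-refl x)))
            ... | no x≢w = trans (trans (𝐂.*-congʳ (A-≢ (x≢w ∘ R≡zero⇒≡))) (𝐂.zeroˡ _)) (sym (𝐂.zeroʳ _))

          -- The polynomial with roots θ i, i ∈ S ∖ {k}, has degree |S| - 1 and
          -- separates the k-th shell of χ from the other shells except {x}.
          shell-proportional : ∀ j k → toℕ j ℕ.+ ∣ S ∣ ≤ δ →
            Proportional (E j · shell k) (E j · basis x)
          shell-proportional j k j+s≤δ with k Fin.≟ zero
          ... | yes ≡.refl = shell-zero j
          ... | no k≢0 with k Subset.∈? S
          ... | no k∉S = proportional-zero (·-zero (E j) vanishes)
            where
            vanishes : ∀ y → shell k y ≈ 0#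
            vanishes y with R x y Fin.≟ k
            ... | yes eq = trans (𝐂.*-congˡ (support k k≢0 k∉S y eq)) (𝐂.zeroʳ _)
            ... | no ≢k = 𝐂.zeroˡ _
          ... | yes k∈S = proportional-cong
                (λ y → ∑-cong n λ w → 𝐂.*-congˡ (sym (separate w)))
                (proportional-cong (λ y → sym (·-⊕ (E j) _ _ y))
                (proportional-⊕
                  (proportional-cong (λ y → sym (·-⊙ (E j) r _ y))
                    (proportional-⊙ r (diagonal-χ {j} (nodes∈ l l≤D) j+l≤δ)))
                  (proportional-cong (λ y → sym (·-⊙ (E j) a _ y)) (proportional-⊙ a (shell-zero j)))))
            where
            T : Subset (suc D)
            T = S - k

            l : List (Fin (suc D))
            l = proj₁ (enumerate T)

            l-spec : length l ≡ ∣ T ∣ × All (_∈ˢ T) l × (∀ {i} → i ∈ˢ T → i ∈ l)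
            l-spec = proj₂ (enumerate T)

            -- Since k is in S, removing it lowers the degree below ∣ S ∣. This absorbs the extra
            -- one in `Lower (suc (length l))`, so that j + ∣ S ∣ ≤ δ suffices.
            l<s : suc (length l) ≤ ∣ S ∣
            l<s = ℕ.≤-trans (s≤s (ℕ.≤-reflexive (proj₁ l-spec))) (Subset.x∈p⇒∣p-x∣<∣p∣ k∈S)

            j+l≤δ : toℕ j ℕ.+ suc (length l) ≤ δ
            j+l≤δ = ℕ.≤-trans (ℕ.+-monoʳ-≤ (toℕ j) l<s) j+s≤δ

            l≤D : length l ≤ D
            l≤D = ℕ.≤-trans (ℕ.≤-trans (ℕ.n≤1+n _) (ℕ.≤-trans (ℕ.m≤n+m _ (toℕ j)) j+l≤δ)) δ≤D

            κ⁻¹ : Invertible (rootProduct (map θ l) (θ k))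
            κ⁻¹ = nodes-invertible (All.map (λ i∈T k≡i → x∉p-x k S (subst (_∈ˢ T) (≡.sym k≡i) i∈T))
              (proj₁ (proj₂ l-spec)))

            -- The factor r normalises f(θ k) to 1, and a cancels what r f(G) leaves at the point x
            -- itself.
            r a : ℂ
            r = proj₁ κ⁻¹
            a = - (r * nodes l x x)

            separate : ∀ w → shell k w ≈ r * (nodes l x w * χ w) + a * shell zero w
            separate w = at (R x w) ≡.refl
              where
              off-zero : R x w ≢ zero → a * shell zero w ≈ 0#
              off-zero ≢0 = trans (𝐂.*-congˡ (trans (𝐂.*-congʳ (A-≢ ≢0)) (𝐂.zeroˡ _))) (𝐂.zeroʳ a)

              killed : nodes l x w * χ w ≈ 0# → R x w ≢ zero → R x w ≢ k →
                shell k w ≈ r * (nodes l x w * χ w) + a * shell zero w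
              killed ≈0 ≢0 ≢k = trans (trans (𝐂.*-congʳ (A-≢ ≢k)) (𝐂.zeroˡ _))
                (sym (trans (𝐂.+-cong (trans (𝐂.*-congˡ ≈0) (𝐂.zeroʳ r)) (off-zero ≢0)) (𝐂.+-identityʳ 0#)))

              at : ∀ i → R x w ≡ i → shell k w ≈ r * (nodes l x w * χ w) + a * shell zero w
              at i eq with i Fin.≟ zero
              ... | yes ≡.refl = trans (trans (𝐂.*-congʳ (A-≢ λ eq′ → k≢0 (≡.trans (≡.sym eq′) eq))) (𝐂.zeroˡ _))
                (sym (begin
                  r * (nodes l x w * χ w) + a * (A 𝒳 zero x w * χ w)
                    ≈⟨ 𝐂.+-cong (trans (sym (𝐂.*-assoc r _ _)) (𝐂.*-congʳ (𝐂.*-congˡ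
                         (trans (nodes-at l eq) (sym (nodes-at l (R-refl x)))))))
                         (𝐂.*-congˡ (trans (𝐂.*-congʳ (A-≡ eq)) (𝐂.*-identityˡ (χ w)))) ⟩
                  r * nodes l x x * χ w + a * χ w
                    ≈⟨ 𝐂.distribʳ (χ w) (r * nodes l x x) a ⟨
                  (r * nodes l x x + a) * χ w
                    ≈⟨ trans (𝐂.*-congʳ (𝐂.-‿inverseʳ _)) (𝐂.zeroˡ _) ⟩
                  0# ∎))
              ... | no i≢0 with i Fin.≟ k
              ... | yes ≡.refl = sym (begin
                  r * (nodes l x w * χ w) + a * shell zero w
                    ≈⟨ 𝐂.+-cong (trans (sym (𝐂.*-assoc r _ _))
                           (𝐂.*-congʳ (trans (𝐂.*-congˡ (nodes-at l eq)) (proj₂ κ⁻¹))))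
                         (off-zero λ eq′ → k≢0 (≡.trans (≡.sym eq) eq′)) ⟩
                  1# * χ w + 0#    ≈⟨ 𝐂.+-identityʳ _ ⟩
                  1# * χ w         ≈⟨ 𝐂.*-congʳ (A-≡ eq) ⟨
                  A 𝒳 k x w * χ w  ∎)
              ... | no i≢k = killed
                  (case-S (i Subset.∈? S))
                  (λ eq′ → i≢0 (≡.trans (≡.sym eq) eq′)) (λ eq′ → i≢k (≡.trans (≡.sym eq) eq′))
                where
                case-S : Dec (i ∈ˢ S) → nodes l x w * χ w ≈ 0#
                case-S (yes i∈S) = trans (𝐂.*-congʳ (nodes-zero (subst (_∈ l) (≡.sym eq)
                  (proj₂ (proj₂ l-spec) (Subset.x∈p∧x≢y⇒x∈p-y i∈S i≢k))))) (𝐂.zeroˡ _)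
                case-S (no i∉S) = trans (𝐂.*-congˡ (support i i≢0 i∉S w eq)) (𝐂.zeroʳ _)

-- Elimination of double negations and the design property

E*-· : ∀ {n D} (𝒳 : SymmetricAssociationScheme n D) x k χ y → (E* 𝒳 x k · χ) y ≈ A 𝒳 k x y * χ y
E*-· 𝒳 x k χ y = trans
  (sum-single y {λ w → E* 𝒳 x k y w * χ w} λ w w≢y → trans (𝐂.*-congʳ (off w≢y)) (𝐂.zeroˡ _))
  (𝐂.*-congʳ on)
  where
  off : ∀ {w} → w ≢ y → E* 𝒳 x k y w ≈ 0#
  off {w} w≢y with y Fin.≟ w
  ... | yes y≡w = contradiction (≡.sym y≡w) w≢y
  ... | no _    = refl
  on : E* 𝒳 x k y y ≈ A 𝒳 k x y
  on with y Fin.≟ y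
  ... | yes _  = refl
  ... | no y≢y = contradiction ≡.refl y≢y

-- Double negation commutes with quantification over a finite set, so finitely many inverses can be
-- assumed at once.
¬¬-∀ : ∀ {m} {P : Fin m → Set} → (∀ i → ¬ ¬ P i) → ¬ ¬ (∀ i → P i)
¬¬-∀ = Fin.sequence (RawMonad.rawApplicative ¬¬-Monad)

invertible-cong : ∀ {z w} → z ≈ w → Invertible z → Invertible w
invertible-cong z≈w (r , rz≈1) = r , trans (𝐂.*-congˡ (sym z≈w)) rz≈1

-- An invertible entry of v determines the coefficient, and equality is stable.
proportional-stable : ∀ {n} {u v : Vector ℂ n} x → Invertible (v x) →
  ¬ ¬ Proportional u v → Proportional u v
proportional-stable {u = u} {v} x (r , rv≈1) ¬¬proportional =
  u x * r , λ y → ≈-stable (u y) (u x * r * v y) λ u≉ → ¬¬proportional λ (c , eq) →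
    u≉ (trans (eq y) (𝐂.*-congʳ (sym (begin
      u x * r      ≈⟨ 𝐂.*-congʳ (eq x) ⟩
      c * v x * r  ≈⟨ trans (𝐂.*-assoc c (v x) r) (𝐂.*-congˡ (trans (𝐂.*-comm (v x) r) rv≈1)) ⟩
      c * 1#       ≈⟨ 𝐂.*-identityʳ c ⟩
      c            ∎))))
  where open SetoidReasoning 𝐂.setoid

module _ {n D : ℕ} .{{_ : NonZero n}} (𝒳 : SymmetricAssociationScheme n D)
  {E : Fin (suc D) → Matrix n} (prims : ArePrimitiveIdempotents 𝒳 E) (cometric : IsCometric E)
  (x : Fin n) (χ : Vector ℂ n) {δ s : ℕ} (dual : IsDualDistance E χ δ) (degree : IsDegree 𝒳 x χ s) where
  open SymmetricAssociationScheme 𝒳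
  open Scheme 𝒳

  -- Minimality of δ only refutes that E_m χ is nonzero; stability of equality turns this into
  -- vanishing.
  low-vanish : ∀ m → m ≢ zero → toℕ m < δ → E m · χ ≋ 0ⱽ
  low-vanish m m≢0 m<δ y = ≈0-stable _ λ ≉0 →
    ℕ.<⇒≱ m<δ (proj₂ dual (toℕ m) (m , ≡.refl , m≢0 , λ ≋0 → ≉0 (≋0 y)))

  δ≤D : δ ≤ D
  δ≤D = let (m , m≡δ , _) , _ = dual in subst (_≤ D) m≡δ (ℕ.s≤s⁻¹ (Fin.toℕ<n m))

  outside-support : ∀ i → i ≢ zero → i ∉ˢ proj₁ degree → ∀ y → R x y ≡ i → χ y ≈ 0#
  outside-support i i≢0 i∉S y eq = ≈0-stable (χ y) λ χy≉0 →
    i∉S (Equivalence.from (proj₁ (proj₂ degree) i) (i≢0 , λ ≋0 → χy≉0 (begin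
      χ y              ≈⟨ 𝐂.*-identityˡ (χ y) ⟨
      1# * χ y         ≈⟨ 𝐂.*-congʳ (A-≡ eq) ⟨
      A 𝒳 i x y * χ y  ≈⟨ E*-· 𝒳 x i χ y ⟨
      (E* 𝒳 x i · χ) y ≈⟨ ≋0 y ⟩
      0#               ∎)))
    where open SetoidReasoning 𝐂.setoid

  ¬¬proportional : ∀ (e : Fin (suc D)) → toℕ e ≡ 1 → ∀ j k → toℕ j ℕ.+ s ≤ δ →
    ¬ ¬ Proportional (E j · (E* 𝒳 x k · χ)) (E j · basis x)
  ¬¬proportional e e≡1 j k j+s≤δ ¬proportional =
    -- The goal is now absurdity, so inverses may be assumed: first of the leading coefficients,
    -- which make the θ distinct, then of the differences of the θ.
    ¬¬-∀ (λ m → ≉0⇒¬¬invertible _ (proj₁ (proj₂ (cometric e e≡1 m)))) λ lead-invertible →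
    ¬¬-∀ (λ a → ¬¬-∀ (difference lead-invertible a)) λ θ-invertible →
    ¬proportional (proportional-cong (λ y → ∑-cong n λ w → 𝐂.*-congˡ (sym (E*-· 𝒳 x k χ w)))
      (C.shell-proportional lead-invertible θ-invertible x χ low-vanish (proj₁ degree) δ≤D
        outside-support j k (subst (λ s → toℕ j ℕ.+ s ≤ δ) (≡.sym (proj₂ (proj₂ degree))) j+s≤δ)))
    where
    module C = Cometric 𝒳 prims e (cometric e e≡1)

    difference : (∀ m → Invertible _) → ∀ a b → ¬ ¬ (a ≢ b → Invertible (C.θ a + - C.θ b))
    difference lead-invertible a b ¬inv with a Fin.≟ b
    ... | yes a≡b = ¬inv λ a≢b → contradiction a≡b a≢b
    ... | no a≢b = ≉0⇒¬¬invertible _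
            (λ θa-θb≈0 → C.θ-distinct lead-invertible a b a≢b (𝐂.x∙y⁻¹≈ε⇒x≈y _ _ θa-θb≈0))
            λ inv → ¬inv λ _ → inv

  proportional : ∀ (e : Fin (suc D)) → toℕ e ≡ 1 → ∀ j k → toℕ j ℕ.+ s ≤ δ →
    Proportional (E j · (E* 𝒳 x k · χ)) (E j · basis x)
  proportional e e≡1 j k j+s≤δ = proportional-stable x
    (invertible-cong (sym (·-basis (E j) x x)) (Diagonal.diagonal-invertible 𝒳 prims j x))
    (¬¬proportional e e≡1 j k j+s≤δ)

proportional⇒dependent : ∀ {n} (u v : Vector ℂ n) → Proportional u v → LinearlyDependent u v
proportional⇒dependent u v (c , eq) = 1# , - c , (λ (1≈0 , _) → 1≉0 1≈0) , λ y →
  trans (𝐂.+-cong (trans (𝐂.*-identityˡ (u y)) (eq y)) (sym (𝐂.-‿distribˡ-* c (v y)))) (𝐂.-‿inverseʳ _)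

≤-minus⇒+-≤ : ∀ j δ s → + j ≤ℤ + δ -ℤ + s → j ℕ.+ s ≤ δ
≤-minus⇒+-≤ j δ s j≤δ-s = ℤ.drop‿+≤+
  (subst (+ (j ℕ.+ s) ≤ℤ_) (//-rightDividesˡ (+ s) (+ δ)) (ℤ.+-monoˡ-≤ (+ s) j≤δ-s))

theorem4p3 : ∀ {n D : ℕ} .{{_ : NonZero n}}
    (𝒳 : SymmetricAssociationScheme n D)
    (E : Fin (suc D) → Matrix n) →
    ArePrimitiveIdempotents 𝒳 E →
    IsCometric E →
    (x : Fin n) (χ : Vector ℂ n) →
    IsCode 𝒳 E χ →
    (δ* s : ℕ) → IsDualDistance E χ δ* → IsDegree 𝒳 x χ s →
    (k : Fin (suc D)) →
    IsRelativeDesign E x (+ δ* -ℤ + s) (E* 𝒳 x k · χ) ×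
    (∀ j → 1 ≤ toℕ j → + toℕ j ≤ℤ + δ* -ℤ + s →
    ∃[ c ] E j · (E* 𝒳 x k · χ) ≋ c ⊙ (E j · basis x))
theorem4p3 {D = D} 𝒳 E prims cometric x χ _ δ* s dual degree k =
  (λ j 1≤j j≤ → proportional⇒dependent _ _ (design j 1≤j j≤)) , design
  where
  design : ∀ j → 1 ≤ toℕ j → + toℕ j ≤ℤ + δ* -ℤ + s →
    Proportional (E j · (E* 𝒳 x k · χ)) (E j · basis x)
  -- A nonzero index j forces D ≥ 1, so `suc zero` exists as the index of E_1.
  design j@(suc {suc _} _) _ j≤δ-s = proportional 𝒳 prims cometric x χ dual degree
    (suc zero) ≡.refl j k (≤-minus⇒+-≤ (toℕ j) δ* s j≤δ-s)
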